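{- Let $G$ be a metric graph with $n=|V(G)|$ vertices and vertex weights in $(0,1]$, some vertex having weight $1$. There exists a walk $W$ in $G$ of size $O(n^2)$ such that the infinite walk $\Delta(W)=[W,W,\dots]$ has cost at most $6\,\mathrm{OPT}_G$.
   Context: A metric graph is a complete undirected graph with positive edge lengths satisfying the triangle inequality. A walk of size $k$ is a sequence of $k$ vertices with consecutive vertices adjacent; its length is the sum of its edge lengths. For an infinite walk $M$, the latency $L(M,v)$ is the maximum length of the sub-walk between consecutive occurrences of $v$ ($+\infty$ if $v$ does not occur infinitely often); the cost is $C(M)=\max_v\phi(v)L(M,v)$; $\mathrm{OPT}_G$ is the minimum cost over all infinite walks in $G$.
   Formalization: Edge lengths and vertex weights are taken to be rational numbers instead of real numbers, and the cost bounds compared with the optimum are rational. -}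

module Defs where

open import Data.Nat using (ℕ; zero; suc; _≤_; _<_)
open import Data.Nat.DivMod using (_mod_)
open import Data.Fin using (Fin)
open import Data.Vec using (Vec; lookup)
open import Data.Integer using (+_)
open import Data.Rational using (ℚ; 0ℚ; 1ℚ; _/_) renaming (_+_ to _+ℚ_; _*_ to _*ℚ_; _≤_ to _≤ℚ_; _<_ to _<ℚ_)
open import Data.Product using (Σ; ∃; _×_)
open import Relation.Binary.PropositionalEquality using (_≡_; _≢_)

-- A metric graph on vertex set Fin n: the complete graph K_n with
-- rational edge lengths d u v (u ≢ v), positive, symmetric, triangle inequality.
record MetricGraph (n : ℕ) : Set where
  field
    d        : Fin n → Fin n → ℚ
    d-refl   : ∀ u → d u u ≡ 0ℚ
    d-sym    : ∀ u v → d u v ≡ d v u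
    d-pos    : ∀ u v → u ≢ v → 0ℚ <ℚ d u v
    d-tri    : ∀ u v w → d u w ≤ℚ d u v +ℚ d v w
open MetricGraph public

-- An infinite walk: a sequence of vertices, consecutive ones adjacent
-- (adjacent in the loopless complete graph = distinct).
IsInfWalk : ∀ {n} → (ℕ → Fin n) → Set
IsInfWalk M = ∀ i → M i ≢ M (suc i)

segLen : ∀ {n} → MetricGraph n → (ℕ → Fin n) → ℕ → ℕ → ℚ
segLen G M i zero    = 0ℚ
segLen G M i (suc m) = d G (M i) (M (suc i)) +ℚ segLen G M (suc i) m

-- φ v · L(M, v) ≤ B : v occurs infinitely often in M, and every sub-walk
-- between consecutive occurrences of v has length ℓ with φ v · ℓ ≤ B.
WeightedLatencyLE : ∀ {n} → MetricGraph n → (Fin n → ℚ) → (ℕ → Fin n) → Fin n → ℚ → Set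
WeightedLatencyLE G φ M v B =
  (∀ i → ∃ λ j → i ≤ j × M j ≡ v) ×
  (∀ i m → 1 ≤ m → M i ≡ v → M (i Data.Nat.+ m) ≡ v →
     (∀ k → 1 ≤ k → k < m → M (i Data.Nat.+ k) ≢ v) →
     φ v *ℚ segLen G M i m ≤ℚ B)

CostLE : ∀ {n} → MetricGraph n → (Fin n → ℚ) → (ℕ → Fin n) → ℚ → Set
CostLE G φ M B = ∀ v → WeightedLatencyLE G φ M v B

Δ : ∀ {n k} → Vec (Fin n) (suc k) → (ℕ → Fin n)
Δ {k = k} W i = lookup W (i mod suc k)

six : ℚ
six = + 6 / 1

{-# OPTIONS --safe #-}
-- W is a cheapest word among the finitely many admissible ones of length at most 16 n², so it is
-- enough to turn any walk M of cost B into one admissible word whose cost is at most 6B.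
--
-- Let r have weight 1. Starting at a visit to r after every vertex has been seen, cut M greedily
-- at visits to r into blocks of length at most B, any two consecutive ones of total length at
-- least B. Deleting repetitions turns each block into a closed tour through r of at most n
-- vertices. The word consists of the first 8n tours, with one extra tour inserted after every
-- eighth: the i-th extra tour is one that contains vertex i.
--
-- While v is not met, the tours skipped at the end of one period and at the start of the next
-- come from two v-free stretches of M, each of weighted length at most B. The remaining terms are
-- the tours at the two ends and the extra tours, whose number is about an eighth of the number of
-- skipped tours, itself at most 3/φ(v) per stretch. The total is at most 47/8 B. If none of the
-- first 8n tours meets v, then the extra tour for v bounds the gap in the same way.
module Submission where

open import Defs
open import Data.Nat using (ℕ; suc; _≤_; _*_)
open import Data.Fin using (Fin)
open import Data.Vec using (Vec)
open import Data.Rational using (ℚ; 0ℚ; 1ℚ) renaming (_*_ to _*ℚ_; _<_ to _<ℚ_; _≤_ to _≤ℚ_)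
open import Data.Product using (Σ; ∃; _×_)
open import Relation.Binary.PropositionalEquality using (_≡_)

open import Data.Nat using (zero; _+_; _∸_; _<_; z≤n; s≤s)
import Data.Nat as ℕ
open import Data.Nat.DivMod using (_/_; _%_; _mod_; m≡m%n+[m/n]*n; m%n<n; m/n*n≤m; [m+kn]%n≡m%n; m<n⇒m%n≡m; n%n≡0; m*n/n≡m; +-distrib-/; +-distrib-/-∣ʳ)
open import Data.Nat.Divisibility using (divides)
import Data.Nat.Properties as ℕ
import Data.Nat.Tactic.RingSolver as ℕ-Solver
open import Data.Fin using (toℕ)
import Data.Fin as Fin
import Data.Fin.Properties as Fin
import Data.Integer as ℤ
import Data.Integer.Properties as ℤ
open import Data.Rational using (↥_; ↧ₙ_; mkℚ; *<*) renaming (_+_ to _+ℚ_; _-_ to _-ℚ_; -_ to -ℚ_)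
import Data.Rational as ℚ
import Data.Rational.Properties as ℚ
open import Data.Rational.Solver using (module +-*-Solver)
open +-*-Solver using (solve; _:=_; _:+_; _:*_; _:-_; con)
open import Data.Rational.Unnormalised using (mkℚᵘ)
import Data.Rational.Unnormalised as ℚᵘ
import Data.Rational.Unnormalised.Properties as ℚᵘ
open import Data.List using (List; []; _∷_; _++_; length; lookup; map; concatMap; filter; deduplicate; cartesianProduct; cartesianProductWith; allFin; upTo)
open import Relation.Binary.Bundles using (DecTotalOrder)
open import Data.List.Extrema (DecTotalOrder.totalOrder ℚ.≤-decTotalOrder) using (min; min≤xs; v<min⁺; max; xs≤max; max≤v⁺; argmin; argmin-all; f[argmin]≤f[xs])
open import Data.List.Membership.DecPropositional using (_∈?_)
open import Data.List.Membership.Propositional using (_∈_)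
open import Data.List.Membership.Propositional.Properties using (∈-++⁺ˡ; ∈-++⁺ʳ; ∈-lookup; ∈-deduplicate⁺; ∈-map⁺; ∈-filter⁺; ∈-filter⁻; ∈-upTo⁺; ∈-allFin; ∈-cartesianProduct⁺; ∈-cartesianProductWith⁺; ∈-concat⁺′)
open import Data.List.Properties using (length-++)
open import Data.List.Relation.Unary.All using (All; []; _∷_)
import Data.List.Relation.Unary.All as All
import Data.List.Relation.Unary.All.Properties as All
open import Data.List.Relation.Unary.AllPairs using ([]; _∷_)
open import Data.List.Relation.Unary.Any using (here; there)
open import Data.List.Relation.Unary.Unique.DecPropositional.Properties using (deduplicate-!)
open import Data.List.Relation.Unary.Unique.Propositional using (Unique)
open import Data.Product using (_,_; proj₁; proj₂)
open import Data.Sum using (_⊎_; inj₁; inj₂)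
import Data.Sum as Sum
open import Data.Unit using (⊤; tt)
open import Data.Vec using ([]; _∷_; fromList)
import Data.Vec as Vec
import Data.Vec.Properties as Vec
open import Function using (_∘_)
open import Relation.Nullary using (¬_; ¬?; yes; no; contradiction)
open import Relation.Nullary.Decidable using (_×-dec_; _→-dec_)
open import Relation.Unary using (Decidable)
open import Relation.Binary.PropositionalEquality using (_≢_; refl; sym; trans; cong; cong₂; subst; subst₂; module ≡-Reasoning)

private variable
  n k : ℕ
  u v w x : Fin n
  l : List (Fin n)

-- Rational arithmetic

infixl 5 _+≤_
_+≤_ : ∀ {a b c e} → a ≤ℚ b → c ≤ℚ e → a +ℚ c ≤ℚ b +ℚ e
_+≤_ = ℚ.+-mono-≤

scale : ∀ {a b} c → 0ℚ ≤ℚ c → a ≤ℚ b → c *ℚ a ≤ℚ c *ℚ b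
scale c 0≤c = ℚ.*-monoˡ-≤-nonNeg c {{ℚ.nonNegative 0≤c}}

-- Reduces a linear inequality to a combination L ≤ R of known ones and the identity X - Y = L - R,
-- which is left to the ring solver.
linear : ∀ {X Y L R} → L ≤ℚ R → X +ℚ R ≡ Y +ℚ L → X ≤ℚ Y
linear {X} {Y} {L} {R} L≤R eq = begin
  X               ≡⟨ solve 2 (λ x r → x := x :+ r :- r) refl X R ⟩
  X +ℚ R -ℚ R     ≡⟨ cong (_-ℚ R) eq ⟩
  Y +ℚ L -ℚ R     ≤⟨ ℚ.+-monoˡ-≤ (-ℚ R) (ℚ.+-monoʳ-≤ Y L≤R) ⟩
  Y +ℚ R -ℚ R     ≡⟨ solve 2 (λ y r → y :+ r :- r := y) refl Y R ⟩
  Y               ∎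
  where open ℚ.≤-Reasoning

-- Recursive, so that `nat (suc k)` unfolds to `1ℚ +ℚ nat k`, the form in which the ring identities
-- below use it.
nat : ℕ → ℚ
nat zero    = 0ℚ
nat (suc k) = 1ℚ +ℚ nat k

nat-+ : ∀ a b → nat (a + b) ≡ nat a +ℚ nat b
nat-+ zero    b = sym (ℚ.+-identityˡ (nat b))
nat-+ (suc a) b = trans (cong (1ℚ +ℚ_) (nat-+ a b)) (sym (ℚ.+-assoc 1ℚ (nat a) (nat b)))

nat-* : ∀ a b → nat (a * b) ≡ nat a *ℚ nat b
nat-* zero    b = sym (ℚ.*-zeroˡ (nat b))
nat-* (suc a) b = trans (nat-+ b (a * b)) (trans (cong (nat b +ℚ_) (nat-* a b))
  (solve 2 (λ x y → y :+ x :* y := (con 1ℚ :+ x) :* y) refl (nat a) (nat b)))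

0≤nat : ∀ a → 0ℚ ≤ℚ nat a
0≤nat zero    = ℚ.≤-refl
0≤nat (suc a) = ℚ.≤-trans (ℚ.<⇒≤ (ℚ.positive⁻¹ 1ℚ)) (linear (0≤nat a)
  (solve 1 (λ x → con 1ℚ :+ x := con 1ℚ :+ x :+ con 0ℚ) refl (nat a)))

nat-mono : ∀ {a b} → a ≤ b → nat a ≤ℚ nat b
nat-mono {a} {b} a≤b = linear (0≤nat (b ∸ a)) (begin
  nat a +ℚ nat (b ∸ a) ≡⟨ nat-+ a (b ∸ a) ⟨
  nat (a + (b ∸ a))    ≡⟨ cong nat (ℕ.m+[n∸m]≡n a≤b) ⟩
  nat b                ≡⟨ ℚ.+-identityʳ (nat b) ⟨
  nat b +ℚ 0ℚ          ∎)
  where open ≡-Reasoning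

toℚᵘ-nat : ∀ k → ℚ.toℚᵘ (nat k) ℚᵘ.≃ mkℚᵘ (ℤ.+ k) 0
toℚᵘ-nat zero    = ℚᵘ.≃-refl
toℚᵘ-nat (suc k) = ℚᵘ.≃-trans (ℚ.toℚᵘ-homo-+ 1ℚ (nat k))
  (ℚᵘ.≃-trans (ℚᵘ.+-congʳ ℚᵘ.1ℚᵘ (toℚᵘ-nat k))
    (ℚᵘ.*≡* (cong (ℤ._* ℤ.1ℤ) (cong (λ i → ℤ.1ℤ ℤ.+ i) (ℤ.*-identityʳ (ℤ.+ k))))))

p≤nat∣↥p∣ : ∀ p → p ≤ℚ nat ℤ.∣ ↥ p ∣
p≤nat∣↥p∣ p@(mkℚ i d-1 _) = ℚ.toℚᵘ-cancel-≤
  (ℚᵘ.≤-respʳ-≃ (ℚᵘ.≃-sym (toℚᵘ-nat ℤ.∣ i ∣)) (ℚᵘ.*≤* (lemma i)))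
  where
  lemma : ∀ i → i ℤ.* ℤ.1ℤ ℤ.≤ ℤ.+ ℤ.∣ i ∣ ℤ.* ℤ.+ (suc d-1)
  lemma (ℤ.+ k) = subst₂ ℤ._≤_ (sym (ℤ.*-identityʳ (ℤ.+ k))) (ℤ.pos-* k (suc d-1)) (ℤ.+≤+ (ℕ.m≤m*n k (suc d-1)))
  lemma ℤ.-[1+ k ] = ℤ.-≤+

-- The product is the numerator, a positive integer.
1≤nat↧p*p : ∀ p → 0ℚ <ℚ p → 1ℚ ≤ℚ nat (↧ₙ p) *ℚ p
1≤nat↧p*p p@(mkℚ (ℤ.+ zero) d-1 _) (*<* (ℤ.+<+ ()))
1≤nat↧p*p p@(mkℚ (ℤ.+ suc k) d-1 _) _ = ℚ.toℚᵘ-cancel-≤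
  (ℚᵘ.≤-respʳ-≃ (ℚᵘ.≃-sym (ℚᵘ.≃-trans (ℚ.toℚᵘ-homo-* (nat (suc d-1)) p) (ℚᵘ.*-congʳ (toℚᵘ-nat (suc d-1)))))
    (ℚᵘ.*≤* (ℤ.+≤+ (subst₂ _≤_ (sym (trans (ℕ.*-identityˡ _) (ℕ.+-identityʳ _)))
       (sym (ℕ.*-identityʳ _)) (ℕ.m≤m*n (suc d-1) (suc k))))))

archimedean : ∀ x {ε} → 0ℚ <ℚ ε → ∃ λ k → x <ℚ nat k *ℚ ε
-- `↧ₙ ε` copies of `ε` add up to at least 1, and `suc m` exceeds `x`.
archimedean x {ε} 0<ε = suc m * ↧ₙ ε , (begin-strict
  x                              ≤⟨ p≤nat∣↥p∣ x ⟩
  nat m                          ≡⟨ ℚ.+-identityˡ (nat m) ⟨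
  0ℚ +ℚ nat m                    <⟨ ℚ.+-monoˡ-< (nat m) (ℚ.positive⁻¹ 1ℚ) ⟩
  nat (suc m)                    ≡⟨ ℚ.*-identityʳ (nat (suc m)) ⟨
  nat (suc m) *ℚ 1ℚ              ≤⟨ scale (nat (suc m)) (0≤nat (suc m)) (1≤nat↧p*p ε 0<ε) ⟩
  nat (suc m) *ℚ (nat (↧ₙ ε) *ℚ ε) ≡⟨ ℚ.*-assoc (nat (suc m)) (nat (↧ₙ ε)) ε ⟨
  nat (suc m) *ℚ nat (↧ₙ ε) *ℚ ε ≡⟨ cong (_*ℚ ε) (nat-* (suc m) (↧ₙ ε)) ⟨
  nat (suc m * ↧ₙ ε) *ℚ ε        ∎)
  where
  open ℚ.≤-Reasoning
  m = ℤ.∣ ↥ x ∣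

-- Searching the natural numbers

least : ∀ {P : ℕ → Set} → Decidable P → ∀ x m →
        (∃ λ y → x ≤ y × y < x + m × P y × (∀ k → x ≤ k → k < y → ¬ P k))
        ⊎ (∀ k → x ≤ k → k < x + m → ¬ P k)
least P? x zero = inj₂ λ k x≤k k<x → contradiction (subst (k <_) (ℕ.+-identityʳ x) k<x) (ℕ.≤⇒≯ x≤k)
least P? x (suc m) with P? x
... | yes Px = inj₁ (x , ℕ.≤-refl , ℕ.m<m+n x (s≤s z≤n) , Px , λ k x≤k k<x → contradiction k<x (ℕ.≤⇒≯ x≤k))
... | no ¬Px with least P? (suc x) m
...   | inj₁ (y , x<y , y< , Py , none) =
        inj₁ (y , ℕ.<⇒≤ x<y , subst (y <_) (sym (ℕ.+-suc x m)) y< , Py , none′)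
  where
  none′ : ∀ k → x ≤ k → k < y → ¬ _
  none′ k x≤k k<y with ℕ.m≤n⇒m<n∨m≡n x≤k
  ... | inj₁ x<k  = none k x<k k<y
  ... | inj₂ refl = ¬Px
...   | inj₂ none = inj₂ none′
  where
  none′ : ∀ k → x ≤ k → k < x + suc m → ¬ _
  none′ k x≤k k< with ℕ.m≤n⇒m<n∨m≡n x≤k
  ... | inj₁ x<k  = none k x<k (subst (k <_) (ℕ.+-suc x m) k<)
  ... | inj₂ refl = ¬Px

least-≥ : ∀ {P : ℕ → Set} → Decidable P → ∀ {x j} → x ≤ j → P j →
          ∃ λ y → x ≤ y × P y × (∀ k → x ≤ k → k < y → ¬ P k)
least-≥ P? {x} {j} x≤j Pj with least P? x (suc (j ∸ x))
... | inj₁ (y , x≤y , _ , Py , none) = y , x≤y , Py , none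
... | inj₂ none = contradiction Pj (none j x≤j j<)
  where
  j< : j < x + suc (j ∸ x)
  j< = ℕ.≤-reflexive (sym (trans (ℕ.+-suc x (j ∸ x)) (cong suc (ℕ.m+[n∸m]≡n x≤j))))

greatest-≤ : ∀ {P : ℕ → Set} → Decidable P → ∀ i {a} → a ≤ i → P a →
             ∃ λ b → a ≤ b × b ≤ i × P b × (∀ k → b < k → k ≤ i → ¬ P k)
greatest-≤ P? i a≤i Pa with P? i
... | yes Pi = i , a≤i , ℕ.≤-refl , Pi , λ k i<k k≤i → contradiction i<k (ℕ.≤⇒≯ k≤i)
greatest-≤ P? zero z≤n Pa | no ¬Pi = contradiction Pa ¬Pi
greatest-≤ {P} P? (suc i) a≤i Pa | no ¬Pi with ℕ.m≤n⇒m<n∨m≡n a≤i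
... | inj₂ refl = contradiction Pa ¬Pi
... | inj₁ (s≤s a≤i′) with greatest-≤ P? i a≤i′ Pa
...   | b , a≤b , b≤i , Pb , none = b , a≤b , ℕ.m≤n⇒m≤1+n b≤i , Pb , none′
  where
  none′ : ∀ k → b < k → k ≤ suc i → ¬ P k
  none′ k b<k k≤ with ℕ.m≤n⇒m<n∨m≡n k≤
  ... | inj₁ (s≤s k≤i) = none k b<k k≤i
  ... | inj₂ refl      = ¬Pi

-- Used with `f` listing the starts of blocks, to find the block that contains position `k`.
bracket : ∀ (f : ℕ → ℕ) m {k} → f 0 ≤ k → k < f m → ∃ λ x → x < m × f x ≤ k × k < f (suc x)
bracket f zero    {k} f0≤k k<f0 = contradiction k<f0 (ℕ.≤⇒≯ f0≤k)
bracket f (suc m) {k} f0≤k k<f with f m ℕ.≤? k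
... | yes fm≤k = m , ℕ.≤-refl , fm≤k , k<f
... | no  fm≰k with bracket f m f0≤k (ℕ.≰⇒> fm≰k)
...   | x , x<m , p , q = x , ℕ.m<n⇒m<1+n x<m , p , q

-- Words and their lengths

Unique⇒lookup-injective : Unique l → ∀ i j → lookup l i ≡ lookup l j → i ≡ j
Unique⇒lookup-injective (x∉ ∷ ul) Fin.zero Fin.zero eq = refl
Unique⇒lookup-injective {l = _ ∷ l} (x∉ ∷ ul) Fin.zero (Fin.suc j) eq = contradiction eq (All.lookup x∉ (∈-lookup j))
Unique⇒lookup-injective {l = _ ∷ l} (x∉ ∷ ul) (Fin.suc i) Fin.zero eq = contradiction (sym eq) (All.lookup x∉ (∈-lookup i))
Unique⇒lookup-injective (x∉ ∷ ul) (Fin.suc i) (Fin.suc j) eq = cong Fin.suc (Unique⇒lookup-injective ul i j eq)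

Unique⇒length≤ : {l : List (Fin n)} → Unique l → length l ≤ n
Unique⇒length≤ ul = Fin.injective⇒≤ (λ {i} {j} → Unique⇒lookup-injective ul i j)

-- The endpoints are kept apart from the interior `l`, so that a closed tour is its root followed by
-- `l`, without the root repeated at the end.
Adjacent : Fin n → List (Fin n) → Fin n → Set
Adjacent u []      w = u ≢ w
Adjacent u (x ∷ l) w = u ≢ x × Adjacent x l w

Adjacent-++ : ∀ (l : List (Fin n)) {l′} → Adjacent u l v → Adjacent v l′ w → Adjacent u (l ++ v ∷ l′) w
Adjacent-++ []      u≢v       a = u≢v , a
Adjacent-++ (x ∷ l) (u≢x , b) a = u≢x , Adjacent-++ l b a

Unique⇒Adjacent : Unique (u ∷ l) → All (w ≢_) (u ∷ l) → Adjacent u l w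
Unique⇒Adjacent {l = []}    _                        (w≢u ∷ [])  = w≢u ∘ sym
Unique⇒Adjacent {l = x ∷ l} ((u≢x ∷ _) ∷ ul) (_ ∷ w∉l) = u≢x , Unique⇒Adjacent ul w∉l

Follows : (ℕ → Fin n) → ℕ → List (Fin n) → Set
Follows U i []      = ⊤
Follows U i (x ∷ l) = U i ≡ x × Follows U (suc i) l

Follows-++⁻ : ∀ (U : ℕ → Fin n) i l {l′} → Follows U i (l ++ l′) →
              Follows U i l × Follows U (i + length l) l′
Follows-++⁻ U i []      {l′} f = tt , subst (λ j → Follows U j l′) (sym (ℕ.+-identityʳ i)) f
Follows-++⁻ U i (x ∷ l) {l′} (e , f) with Follows-++⁻ U (suc i) l f
... | f₁ , f₂ = (e , f₁) , subst (λ j → Follows U j l′) (sym (ℕ.+-suc i (length l))) f₂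

Follows-∈ : ∀ (U : ℕ → Fin n) i {l} → Follows U i l → v ∈ l →
            ∃ λ j → i ≤ j × j < i + length l × U j ≡ v
Follows-∈ U i {x ∷ l} (e , f) (here refl) = i , ℕ.≤-refl , ℕ.m<m+n i (s≤s z≤n) , e
Follows-∈ U i {x ∷ l} (e , f) (there v∈l) with Follows-∈ U (suc i) f v∈l
... | j , i<j , j< , Uj = j , ℕ.<⇒≤ i<j , subst (j <_) (sym (ℕ.+-suc i (length l))) j< , Uj

Follows-adjacent : ∀ (U : ℕ → Fin n) i {u l} → Follows U i (u ∷ l) → Adjacent u l w →
                   U (i + suc (length l)) ≡ w → ∀ k → k ≤ length l → U (i + k) ≢ U (suc (i + k))
Follows-adjacent U i {u} {[]} (Ui , _) u≢w Uw zero z≤n eq rewrite ℕ.+-identityʳ i =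
  u≢w (trans (sym Ui) (trans eq (trans (cong U (sym (trans (ℕ.+-suc i 0) (cong suc (ℕ.+-identityʳ i))))) Uw)))
Follows-adjacent U i {u} {x ∷ l} (Ui , Ux , f) (u≢x , a) Uw zero z≤n eq rewrite ℕ.+-identityʳ i =
  u≢x (trans (sym Ui) (trans eq Ux))
Follows-adjacent U i {u} {x ∷ l} (Ui , f) (u≢x , a) Uw (suc k) (s≤s k≤) eq rewrite ℕ.+-suc i k =
  Follows-adjacent U (suc i) f a (trans (cong U (sym (ℕ.+-suc i (suc (length l))))) Uw) k k≤ eq

stretch : (ℕ → Fin n) → ℕ → ℕ → List (Fin n)
stretch U i zero    = []
stretch U i (suc m) = U i ∷ stretch U (suc i) m

length-stretch : ∀ (U : ℕ → Fin n) i m → length (stretch U i m) ≡ m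
length-stretch U i zero    = refl
length-stretch U i (suc m) = cong suc (length-stretch U (suc i) m)

Follows-stretch : ∀ (U : ℕ → Fin n) i m → Follows U i (stretch U i m)
Follows-stretch U i zero    = tt
Follows-stretch U i (suc m) = refl , Follows-stretch U (suc i) m

∈-stretch : ∀ (U : ℕ → Fin n) i m {j} → i ≤ j → j < i + m → U j ∈ stretch U i m
∈-stretch U i zero    i≤j j< = contradiction (subst (_ <_) (ℕ.+-identityʳ i) j<) (ℕ.≤⇒≯ i≤j)
∈-stretch U i (suc m) {j} i≤j j< with ℕ.m≤n⇒m<n∨m≡n i≤j
... | inj₁ i<j  = there (∈-stretch U (suc i) m i<j (subst (j <_) (ℕ.+-suc i m) j<))
... | inj₂ refl = here refl

-- Lengths along a walk, and shortcutting to tours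

module _ (G : MetricGraph n) where

  0≤d : ∀ u v → 0ℚ ≤ℚ d G u v
  0≤d u v with u Fin.≟ v
  ... | yes refl = ℚ.≤-reflexive (sym (d-refl G u))
  ... | no  u≢v  = ℚ.<⇒≤ (d-pos G u v u≢v)

  -- Turns lengths of sub-walks into differences, so that comparing overlapping sub-walks becomes
  -- linear arithmetic.
  odometer : (ℕ → Fin n) → ℕ → ℚ
  odometer U zero    = 0ℚ
  odometer U (suc i) = odometer U i +ℚ d G (U i) (U (suc i))

  segLen-odometer : ∀ U i m → segLen G U i m +ℚ odometer U i ≡ odometer U (i + m)
  segLen-odometer U i zero    = trans (ℚ.+-identityˡ _) (cong (odometer U) (sym (ℕ.+-identityʳ i)))
  segLen-odometer U i (suc m) = begin
    d G (U i) (U (suc i)) +ℚ segLen G U (suc i) m +ℚ odometer U i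
      ≡⟨ solve 3 (λ e s o → e :+ s :+ o := s :+ (o :+ e)) refl (d G (U i) (U (suc i))) _ _ ⟩
    segLen G U (suc i) m +ℚ odometer U (suc i) ≡⟨ segLen-odometer U (suc i) m ⟩
    odometer U (suc i + m)                     ≡⟨ cong (odometer U) (ℕ.+-suc i m) ⟨
    odometer U (i + suc m)                     ∎
    where open ≡-Reasoning

  odometer-mono : ∀ U {i j} → i ≤ j → odometer U i ≤ℚ odometer U j
  odometer-mono U {j = zero} z≤n = ℚ.≤-refl
  odometer-mono U {i} {suc j} i≤ with ℕ.m≤n⇒m<n∨m≡n i≤
  ... | inj₂ refl = ℚ.≤-refl
  ... | inj₁ (s≤s i≤j) = ℚ.≤-trans (odometer-mono U i≤j) (linear (0≤d (U j) (U (suc j)))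
        (solve 2 (λ o e → o :+ e := o :+ e :+ con 0ℚ) refl (odometer U j) _))

  pathLen : Fin n → List (Fin n) → Fin n → ℚ
  pathLen u []      w = d G u w
  pathLen u (x ∷ l) w = d G u x +ℚ pathLen x l w

  pathLen-++ : ∀ u l v l′ w → pathLen u (l ++ v ∷ l′) w ≡ pathLen u l v +ℚ pathLen v l′ w
  pathLen-++ u []      v l′ w = refl
  pathLen-++ u (x ∷ l) v l′ w = trans (cong (d G u x +ℚ_) (pathLen-++ x l v l′ w))
                                      (sym (ℚ.+-assoc (d G u x) _ _))

  -- Only the first edge changes, so one triangle inequality suffices.
  pathLen-∷ : ∀ u x l w → pathLen u l w ≤ℚ d G u x +ℚ pathLen x l w
  pathLen-∷ u x []      w = d-tri G u x w
  pathLen-∷ u x (y ∷ l) w = linear (d-tri G u x y)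
    (solve 4 (λ uy p ux xy → uy :+ p :+ (ux :+ xy) := ux :+ (xy :+ p) :+ uy) refl (d G u y) (pathLen y l w) (d G u x) (d G x y))

  -- Each dropped vertex is bypassed by the triangle inequality.
  pathLen-filter : ∀ {P : Fin n → Set} (P? : Decidable P) u l w → pathLen u (filter P? l) w ≤ℚ pathLen u l w
  pathLen-filter P? u []      w = ℚ.≤-refl
  pathLen-filter P? u (x ∷ l) w with P? x
  ... | yes _ = ℚ.+-monoʳ-≤ (d G u x) (pathLen-filter P? x l w)
  ... | no  _ = ℚ.≤-trans (pathLen-filter P? u l w) (pathLen-∷ u x l w)

  pathLen-deduplicate : ∀ u l w → pathLen u (deduplicate Fin._≟_ l) w ≤ℚ pathLen u l w
  pathLen-deduplicate u []      w = ℚ.≤-refl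
  pathLen-deduplicate u (x ∷ l) w = ℚ.+-monoʳ-≤ (d G u x)
    (ℚ.≤-trans (pathLen-filter (¬? ∘ (x Fin.≟_)) x (deduplicate Fin._≟_ l) w) (pathLen-deduplicate x l w))

  odometer-Follows : ∀ U i {u l} → Follows U i (u ∷ l) → U (i + suc (length l)) ≡ w →
                     odometer U (i + suc (length l)) ≡ odometer U i +ℚ pathLen u l w
  odometer-Follows U i {l = []} (refl , _) Uw rewrite ℕ.+-suc i 0 | ℕ.+-identityʳ i | Uw = refl
  odometer-Follows U i {l = x ∷ l} (refl , refl , f) Uw rewrite ℕ.+-suc i (suc (length l)) =
    trans (odometer-Follows U (suc i) (refl , f) Uw) (ℚ.+-assoc (odometer U i) _ _)

  -- Keeping the first occurrence of each vertex between two visits to `r` preserves the set of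
  -- vertices and, by the triangle inequality, does not lengthen the tour.
  shortcut : ∀ {M : ℕ → Fin n} {r} → IsInfWalk M → ∀ i m → M i ≡ r → M (i + suc m) ≡ r →
             ∃ λ l → Unique (r ∷ l) × Adjacent r l r ×
               odometer M i +ℚ pathLen r l r ≤ℚ odometer M (i + suc m) ×
               (∀ k → i ≤ k → k < i + suc m → M k ∈ r ∷ l)
  shortcut {M} walk i zero refl Mi+1 =
    contradiction (sym (trans (cong M (sym (trans (ℕ.+-suc i 0) (cong suc (ℕ.+-identityʳ i))))) Mi+1)) (walk i)
  shortcut {M} {r} walk i (suc m) refl back =
    t , unique , adjacent , length≤ , covers
    where
    s t : List (Fin n)
    s = stretch M (suc i) (suc m)
    -- Written out so that `r ∷ t` is by computation the deduplication of `r ∷ s`.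
    t = filter (¬? ∘ (r Fin.≟_)) (deduplicate Fin._≟_ s)
    unique : Unique (r ∷ t)
    unique = deduplicate-! Fin._≟_ (r ∷ s)
    covers : ∀ k → i ≤ k → k < i + suc (suc m) → M k ∈ r ∷ t
    covers k i≤k k< = ∈-deduplicate⁺ Fin._≟_ (∈-stretch M i (suc (suc m)) i≤k k<)
    adjacent : Adjacent r t r
    adjacent with t | unique | covers (suc i) (ℕ.n≤1+n i)
                    (subst (suc i <_) (sym (ℕ.+-suc i (suc m))) (s≤s (ℕ.m<m+n i (s≤s z≤n))))
    -- An empty interior would require `r ≢ r`; it cannot arise, because the vertex after `r`
    -- differs from `r` and is covered.
    ... | []    | _              | here eq = contradiction (sym eq) (walk i)
    ... | _ ∷ _ | (r∉ ∷ ul) | _       = All.head r∉ , Unique⇒Adjacent ul r∉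
    length≤ : odometer M i +ℚ pathLen r t r ≤ℚ odometer M (i + suc (suc m))
    length≤ = begin
      odometer M i +ℚ pathLen r t r
        ≤⟨ ℚ.+-monoʳ-≤ (odometer M i) (ℚ.≤-trans (pathLen-filter (¬? ∘ (r Fin.≟_)) r (deduplicate Fin._≟_ s) r) (pathLen-deduplicate r s r)) ⟩
      odometer M i +ℚ pathLen r s r
        ≡⟨ odometer-Follows M i (Follows-stretch M i (suc (suc m))) (trans (cong (λ k → M (i + suc k)) (length-stretch M (suc i) (suc m))) back) ⟨
      odometer M (i + suc (length s)) ≡⟨ cong (λ k → odometer M (i + suc k)) (length-stretch M (suc i) (suc m)) ⟩
      odometer M (i + suc (suc m)) ∎
      where open ℚ.≤-Reasoning

-- Cutting a walk into tours

bounded : ∀ (f : Fin n → ℕ) → ∃ λ s → ∀ v → f v ≤ s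
bounded {zero}  f = 0 , λ ()
bounded {suc n} f with bounded (f ∘ Fin.suc)
... | s , f≤s = f Fin.zero ℕ.⊔ s , λ where
  Fin.zero    → ℕ.m≤m⊔n (f Fin.zero) s
  (Fin.suc v) → ℕ.≤-trans (f≤s v) (ℕ.m≤n⊔m (f Fin.zero) s)

module _ (G : MetricGraph n) where

  shortestEdge : ∃ λ ε → 0ℚ <ℚ ε × (∀ u v → u ≢ v → ε ≤ℚ d G u v)
  shortestEdge = min 1ℚ lengths , ℚ.≰⇒> min≰0 , ≤edge
    where
    pairs = cartesianProduct (allFin n) (allFin n)
    edge : Fin n × Fin n → ℚ
    edge (u , v) with u Fin.≟ v
    -- The diagonal, where `d` vanishes, gets a positive filler so that the minimum stays positive.
    ... | yes _ = 1ℚ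
    ... | no  _ = d G u v
    lengths = map edge pairs
    edge>0 : ∀ uv → 0ℚ <ℚ edge uv
    edge>0 (u , v) with u Fin.≟ v
    ... | yes _  = ℚ.positive⁻¹ 1ℚ
    ... | no u≢v = d-pos G u v u≢v
    strict : ∀ {p q} → p <ℚ q → p ≤ℚ q × p ≢ q
    strict p<q = ℚ.<⇒≤ p<q , ℚ.<⇒≢ p<q
    min≰0 : ¬ min 1ℚ lengths ≤ℚ 0ℚ
    min≰0 min≤0 with v<min⁺ {v = 0ℚ} {⊤ = 1ℚ} {xs = lengths} (strict (ℚ.positive⁻¹ 1ℚ))
                       (All.map⁺ (All.universal (λ uv → strict (edge>0 uv)) pairs))
    ... | 0≤min , 0≢min = 0≢min (ℚ.≤-antisym 0≤min min≤0)
    ≤edge : ∀ u v → u ≢ v → min 1ℚ lengths ≤ℚ d G u v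
    ≤edge u v u≢v with edge (u , v) | All.lookup (min≤xs 1ℚ lengths) (∈-map⁺ edge (∈-cartesianProduct⁺ (∈-allFin u) (∈-allFin v))) | edge≡
      where
      edge≡ : edge (u , v) ≡ d G u v
      edge≡ with u Fin.≟ v
      ... | yes u≡v = contradiction u≡v u≢v
      ... | no  _   = refl
    ... | _ | min≤ | refl = min≤

  odometer-grows : ∀ {M ε} → IsInfWalk M → (∀ u v → u ≢ v → ε ≤ℚ d G u v) →
                   ∀ i m → odometer G M i +ℚ nat m *ℚ ε ≤ℚ odometer G M (i + m)
  odometer-grows {M} {ε} walk ε≤ i zero    = ℚ.≤-reflexive (trans (cong (odometer G M i +ℚ_) (ℚ.*-zeroˡ ε))
    (trans (ℚ.+-identityʳ _) (cong (odometer G M) (sym (ℕ.+-identityʳ i)))))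
  odometer-grows {M} {ε} walk ε≤ i (suc m) rewrite ℕ.+-suc i m =
    linear (odometer-grows walk ε≤ i m +≤ ε≤ _ _ (walk (i + m)))
      (solve 5 (λ o m ε o′ e → o :+ (con 1ℚ :+ m) :* ε :+ (o′ :+ e) := o′ :+ e :+ (o :+ m :* ε :+ ε)) refl
        (odometer G M i) (nat m) ε (odometer G M (i + m)) (d G (M (i + m)) (M (suc (i + m)))))

  abstract
    -- Every edge is at least as long as the shortest one, so `m` is uniform in `i`. This bounds the
    -- search for the last visit to the root within length `B`.
    odometer-unbounded : ∀ {M} → IsInfWalk M → ∀ B → ∃ λ m → ∀ i → odometer G M i +ℚ B <ℚ odometer G M (i + m)
    odometer-unbounded {M} walk B =
      let ε , 0<ε , ε≤ = shortestEdge
          m , B<       = archimedean B 0<ε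
      in m , λ i → ℚ.<-≤-trans (ℚ.+-monoʳ-< (odometer G M i) B<) (odometer-grows walk ε≤ i m)

-- A closed walk through root for each consecutive block of an infinite walk;
-- elapsed b is the length of that walk up to the start of block b.
record Tours (G : MetricGraph n) (φ : Fin n → ℚ) (B : ℚ) : Set where
  field
    root     : Fin n
    tour     : ℕ → List (Fin n)
    elapsed  : ℕ → ℚ
    short    : ∀ b → length (root ∷ tour b) ≤ n
    adjacent : ∀ b → Adjacent root (tour b) root
    tour≤    : ∀ b → elapsed b +ℚ pathLen G root (tour b) root ≤ℚ elapsed (suc b)
    block≤   : ∀ b → elapsed (suc b) ≤ℚ elapsed b +ℚ B
    twoBlocks≥ : ∀ b → elapsed b +ℚ B ≤ℚ elapsed (suc (suc b))
    missed≤  : ∀ v a b → a ≤ b → (∀ k → a ≤ k → k < b → ¬ v ∈ root ∷ tour k) →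
               φ v *ℚ (elapsed b -ℚ elapsed a) ≤ℚ B
    visited  : ∀ v → ∃ λ b → v ∈ root ∷ tour b

-- Greedy blocks between visits to a vertex of weight 1

module _ (G : MetricGraph n) (φ : Fin n → ℚ) (0≤φ : ∀ v → 0ℚ ≤ℚ φ v)
         {M : ℕ → Fin n} (walk : IsInfWalk M) {B : ℚ} (cost : CostLE G φ M B) where
  private
    D = odometer G M

  latency : ∀ v {a b} → a < b → M a ≡ v → M b ≡ v → (∀ k → a < k → k < b → M k ≢ v) →
            φ v *ℚ (D b -ℚ D a) ≤ℚ B
  latency v {a} {b} a<b Ma Mb none =
    subst (λ x → φ v *ℚ x ≤ℚ B) seg≡
      (proj₂ (cost v) a m (ℕ.m<n⇒0<n∸m a<b) Ma (trans (cong M a+m) Mb)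
        λ k 1≤k k<m → none (a + k) (ℕ.m<m+n a 1≤k) (subst (a + k <_) a+m (ℕ.+-monoʳ-< a k<m)))
    where
    m = b ∸ a
    a+m : a + m ≡ b
    a+m = ℕ.m+[n∸m]≡n (ℕ.<⇒≤ a<b)
    seg≡ : segLen G M a m ≡ D b -ℚ D a
    seg≡ = trans (solve 2 (λ s o → s := s :+ o :- o) refl (segLen G M a m) (D a))
      (cong (_-ℚ D a) (trans (segLen-odometer G M a m) (cong D a+m)))

  abstract
    return : ∀ v {a} → M a ≡ v → ∃ λ b → a < b × M b ≡ v × φ v *ℚ (D b -ℚ D a) ≤ℚ B
    return v {a} Ma with proj₁ (cost v) (suc a)
    ... | j , a<j , Mj with least-≥ (λ k → M k Fin.≟ v) a<j Mj
    ...   | b , a<b , Mb , none = b , a<b , Mb , latency v a<b Ma Mb none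

  -- `B` dominates the weighted length of a return to `v`, which is non-negative.
  0≤bound : Fin n → 0ℚ ≤ℚ B
  0≤bound v with proj₁ (cost v) 0
  ... | a , _ , Ma with return v Ma
  ...   | b , a<b , _ , ≤B = ℚ.≤-trans
    (subst (_≤ℚ φ v *ℚ (D b -ℚ D a)) (ℚ.*-zeroʳ (φ v)) (scale (φ v) (0≤φ v)
      (linear (odometer-mono G M (ℕ.<⇒≤ a<b)) (solve 2 (λ x y → con 0ℚ :+ y := y :- x :+ x) refl (D a) (D b)))))
    ≤B

  -- The stretch lies between the last visit to `v` up to `i` and the first one from `j` on, which
  -- are consecutive occurrences. The given earlier visit ensures that the former exists.
  avoided≤ : ∀ v {a i j} → a ≤ i → M a ≡ v → i ≤ j → (∀ k → i ≤ k → k < j → M k ≢ v) →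
             φ v *ℚ (D j -ℚ D i) ≤ℚ B
  avoided≤ v {a₀} {i} {j} a₀≤i Ma₀ i≤j none with ℕ.m≤n⇒m<n∨m≡n i≤j
  -- An empty stretch is treated apart: it may sit on a visit to `v`, where the two surrounding
  -- visits coincide.
  ... | inj₂ refl = subst (_≤ℚ B) (solve 2 (λ f x → con 0ℚ := f :* (x :- x)) refl (φ v) (D i)) (0≤bound v)
  ... | inj₁ i<j with greatest-≤ (λ k → M k Fin.≟ v) i a₀≤i Ma₀ | proj₁ (cost v) j
  ...   | a , _ , a≤i , Ma , after | c , j≤c , Mc with least-≥ (λ k → M k Fin.≟ v) j≤c Mc
  ...     | b , j≤b , Mb , before = ℚ.≤-trans
      (scale (φ v) (0≤φ v) (linear (odometer-mono G M j≤b +≤ odometer-mono G M a≤i)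
        (solve 4 (λ a b i j → j :- i :+ (b :+ i) := b :- a :+ (j :+ a)) refl (D a) (D b) (D i) (D j))))
      (latency v (ℕ.≤-<-trans a≤i (ℕ.<-≤-trans i<j j≤b)) Ma Mb none′)
    where
    none′ : ∀ k → a < k → k < b → M k ≢ v
    none′ k a<k k<b with ℕ.≤-<-connex k i | ℕ.≤-<-connex j k
    ... | inj₁ k≤i | _        = after k a<k k≤i
    ... | inj₂ i<k | inj₁ j≤k = before k j≤k k<b
    ... | inj₂ i<k | inj₂ k<j = none k (ℕ.<⇒≤ i<k) k<j

  module _ (r : Fin n) (φr≡1 : φ r ≡ 1ℚ) where

    return≤ : ∀ {i j} → φ r *ℚ (D j -ℚ D i) ≤ℚ B → D j ≤ℚ D i +ℚ B
    return≤ {i} {j} ≤B = linear (subst (λ f → f *ℚ (D j -ℚ D i) ≤ℚ B) φr≡1 ≤B)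
      (solve 3 (λ i j b → j :+ b := i :+ b :+ con 1ℚ :* (j :- i)) refl (D i) (D j) B)

    WithinBound : ℕ → ℕ → Set
    WithinBound i j = M j ≡ r × D j ≤ℚ D i +ℚ B

    withinBound? : ∀ i → Decidable (WithinBound i)
    withinBound? i j = (M j Fin.≟ r) ×-dec (D j ℚ.≤? D i +ℚ B)

    abstract
      -- The greedy cut: `j` is the last visit to `r` within length `B` of `i`. As `r` has weight 1,
      -- its next return is already within `B`, hence `i < j`.
      block : ∀ i → M i ≡ r → ∃ λ j → i < j × WithinBound i j ×
              (∀ k → j < k → M k ≡ r → D i +ℚ B <ℚ D k)
      block i Mi =
        let j₀ , i<j₀ , Mj₀ , ≤B           = return r Mi
            m , far                        = odometer-unbounded G walk B
            -- From `i + m` on the odometer exceeds `D i +ℚ B`, so the search can stop there; the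
            -- maximum keeps the known return `j₀` in range.
            top                            = (i + m) ℕ.⊔ j₀
            j , j₀≤j , j≤ , within , none = greatest-≤ (withinBound? i) top (ℕ.m≤n⊔m (i + m) j₀) (Mj₀ , return≤ {i} {j₀} ≤B)
            beyond : ∀ k → j < k → M k ≡ r → D i +ℚ B <ℚ D k
            beyond k j<k Mk = Sum.[
              (λ k≤ → ℚ.≰⇒> λ Dk≤ → none k j<k k≤ (Mk , Dk≤)) ,
              (λ <k → ℚ.<-≤-trans (far i) (odometer-mono G M (ℕ.≤-trans (ℕ.m≤m⊔n (i + m) j₀) (ℕ.<⇒≤ <k)))) ]
              (ℕ.≤-<-connex k top)
        in j , ℕ.<-≤-trans i<j₀ j₀≤j , within , beyond

    abstract
      -- Starting after every vertex has occurred supplies the earlier visit that `avoided≤` asks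
      -- for.
      start : ∃ λ s → M s ≡ r × (∀ v → ∃ λ a → a ≤ s × M a ≡ v)
      start with bounded (λ v → proj₁ (proj₁ (cost v) 0))
      ... | s₀ , ≤s₀ with proj₁ (cost r) s₀
      ...   | s , s₀≤s , Ms = s , Ms , λ v → proj₁ (proj₁ (cost v) 0) , ℕ.≤-trans (≤s₀ v) s₀≤s , proj₂ (proj₂ (proj₁ (cost v) 0))

    private
      s₀ = proj₁ start

      visit : ℕ → Σ ℕ λ i → M i ≡ r
      visit zero    = s₀ , proj₁ (proj₂ start)
      visit (suc b) with visit b
      ... | i , Mi with block i Mi
      ...   | j , _ , (Mj , _) , _ = j , Mj

      p : ℕ → ℕ
      p b = proj₁ (visit b)

      p-< : ∀ b → p b < p (suc b)
      p-< b with visit b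
      ... | i , Mi with block i Mi
      ...   | j , i<j , _ = i<j

      p-mono : ∀ {a b} → a ≤ b → p a ≤ p b
      p-mono {b = zero} z≤n = ℕ.≤-refl
      p-mono {a} {suc b} a≤ with ℕ.m≤n⇒m<n∨m≡n a≤
      ... | inj₁ (s≤s a≤b) = ℕ.≤-trans (p-mono a≤b) (ℕ.<⇒≤ (p-< b))
      ... | inj₂ refl      = ℕ.≤-refl

      b≤p : ∀ b → b ≤ p b
      b≤p zero    = z≤n
      b≤p (suc b) = ℕ.≤-<-trans (b≤p b) (p-< b)

      p-block≤ : ∀ b → D (p (suc b)) ≤ℚ D (p b) +ℚ B
      p-block≤ b with visit b
      ... | i , Mi with block i Mi
      ...   | j , _ , (_ , ≤B) , _ = ≤B

      p-beyond : ∀ b k → p (suc b) < k → M k ≡ r → D (p b) +ℚ B <ℚ D k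
      p-beyond b with visit b
      ... | i , Mi with block i Mi
      ...   | j , _ , _ , beyond = beyond

      -- The number of positions strictly between two cuts, matching the `suc m` in `shortcut`.
      gap : ℕ → ℕ
      gap b = p (suc b) ∸ suc (p b)

      p+gap : ∀ b → p b + suc (gap b) ≡ p (suc b)
      p+gap b = trans (ℕ.+-suc (p b) (gap b)) (ℕ.m+[n∸m]≡n (p-< b))

      loop : ∀ b → ∃ λ l → Unique (r ∷ l) × Adjacent r l r ×
               D (p b) +ℚ pathLen G r l r ≤ℚ D (p b + suc (gap b)) ×
               (∀ k → p b ≤ k → k < p b + suc (gap b) → M k ∈ r ∷ l)
      loop b = shortcut G walk (p b) (gap b) (proj₂ (visit b)) (trans (cong M (p+gap b)) (proj₂ (visit (suc b))))

      covers : ∀ b k → p b ≤ k → k < p (suc b) → M k ∈ r ∷ proj₁ (loop b)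
      covers b k p≤ k< = proj₂ (proj₂ (proj₂ (proj₂ (loop b)))) k p≤ (subst (k <_) (sym (p+gap b)) k<)

      -- A visit to `v` between the two cuts would fall in a block `c` with `a ≤ c < b`, whose tour
      -- would contain `v`.
      missed : ∀ v a b → a ≤ b → (∀ k → a ≤ k → k < b → ¬ v ∈ r ∷ proj₁ (loop k)) →
               φ v *ℚ (D (p b) -ℚ D (p a)) ≤ℚ B
      missed v a b a≤b none with proj₂ (proj₂ start) v
      ... | a₀ , a₀≤ , Ma₀ = avoided≤ v (ℕ.≤-trans a₀≤ (p-mono {b = a} z≤n)) Ma₀ (p-mono a≤b) none′
        where
        none′ : ∀ k → p a ≤ k → k < p b → M k ≢ v
        none′ k pa≤k k<pb refl with bracket p b (ℕ.≤-trans (p-mono {b = a} z≤n) pa≤k) k<pb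
        ... | c , c<b , pc≤k , k<pc′ = none c a≤c c<b (covers c k pc≤k k<pc′)
          where
          a≤c : a ≤ c
          a≤c with ℕ.≤-<-connex a c
          ... | inj₁ a≤c = a≤c
          ... | inj₂ c<a = contradiction k<pc′ (ℕ.≤⇒≯ (ℕ.≤-trans (p-mono c<a) pa≤k))

      visits : ∀ v → ∃ λ b → v ∈ r ∷ proj₁ (loop b)
      visits v with proj₁ (cost v) s₀
      -- Cuts strictly increase, so cut number `suc k` lies beyond position `k`.
      ... | k , s₀≤k , refl with bracket p (suc k) s₀≤k (b≤p (suc k))
      ...   | b , _ , p≤k , k<p = b , covers b k p≤k k<p

    tours : Tours G φ B
    tours = record
      { root       = r
      ; tour       = λ b → proj₁ (loop b)
      ; elapsed    = λ b → D (p b)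
      ; short      = λ b → Unique⇒length≤ (proj₁ (proj₂ (loop b)))
      ; adjacent   = λ b → proj₁ (proj₂ (proj₂ (loop b)))
      ; tour≤      = λ b → subst (λ j → D (p b) +ℚ pathLen G r (proj₁ (loop b)) r ≤ℚ D j) (p+gap b) (proj₁ (proj₂ (proj₂ (proj₂ (loop b)))))
      ; block≤     = p-block≤
      -- The cut after next is a visit to the root later than the greedy choice, hence out of reach
      -- `B` from cut `b`.
      ; twoBlocks≥ = λ b → ℚ.<⇒≤ (p-beyond b (p (suc (suc b))) (p-< (suc b)) (proj₂ (visit (suc (suc b)))))
      ; missed≤    = missed
      ; visited    = visits
      }

-- Reading a word periodically

lookup-fromList : ∀ {A : Set} (l : List A) i → Vec.lookup (fromList l) i ≡ lookup l i
lookup-fromList (x ∷ l) Fin.zero    = refl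
lookup-fromList (x ∷ l) (Fin.suc i) = lookup-fromList l i

mod-+* : ∀ q k (j : Fin (suc k)) → (q * suc k + toℕ j) mod suc k ≡ j
mod-+* q k j = Fin.toℕ-injective (begin
  toℕ ((q * suc k + toℕ j) mod suc k) ≡⟨ Fin.toℕ-fromℕ< _ ⟩
  (q * suc k + toℕ j) % suc k         ≡⟨ cong (_% suc k) (ℕ.+-comm (q * suc k) (toℕ j)) ⟩
  (toℕ j + q * suc k) % suc k         ≡⟨ [m+kn]%n≡m%n (toℕ j) q (suc k) ⟩
  toℕ j % suc k                       ≡⟨ m<n⇒m%n≡m (Fin.toℕ<n j) ⟩
  toℕ j                               ∎)
  where open ≡-Reasoning

lookup⇒Follows : ∀ (U : ℕ → Fin n) i l → (∀ j → U (i + toℕ j) ≡ lookup l j) → Follows U i l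
lookup⇒Follows U i []      h = tt
lookup⇒Follows U i (x ∷ l) h = trans (cong U (sym (ℕ.+-identityʳ i))) (h Fin.zero) ,
  lookup⇒Follows U (suc i) l λ j → trans (cong U (sym (ℕ.+-suc i (toℕ j)))) (h (Fin.suc j))

Follows-Δ : ∀ (x : Fin n) l q → Follows (Δ (fromList (x ∷ l))) (q * suc (length l)) (x ∷ l)
Follows-Δ x l q = lookup⇒Follows _ _ (x ∷ l) λ j →
  trans (cong (Vec.lookup (fromList (x ∷ l))) (mod-+* q (length l) j)) (lookup-fromList (x ∷ l) j)

Δ-of : ∀ (l : List (Fin n)) → 1 ≤ length l → Σ ℕ λ k → Σ (Vec (Fin n) (suc k)) λ W →
       suc k ≡ length l × (∀ q → Follows (Δ W) (q * length l) l)
Δ-of (x ∷ l) _ = length l , fromList (x ∷ l) , refl , Follows-Δ x l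

suc-/8-≡ : ∀ b → b % 8 ≡ 7 → suc b / 8 ≡ suc (b / 8)
suc-/8-≡ b eq = trans (cong (λ c → suc c / 8) (trans (m≡m%n+[m/n]*n b 8) (cong (_+ b / 8 * 8) eq))) (m*n/n≡m (suc (b / 8)) 8)

suc-/8-≢ : ∀ b → b % 8 ≢ 7 → suc b / 8 ≡ b / 8
suc-/8-≢ b ≢7 = begin
  suc b / 8     ≡⟨ cong (_/ 8) (ℕ.+-comm 1 b) ⟩
  (b + 1) / 8   ≡⟨ +-distrib-/ b 1 (subst (_< 8) (ℕ.+-comm 1 (b % 8)) (s≤s (ℕ.≤∧≢⇒< (ℕ.s≤s⁻¹ (m%n<n b 8)) ≢7))) ⟩
  b / 8 + 0     ≡⟨ ℕ.+-identityʳ (b / 8) ⟩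
  b / 8         ∎
  where open ≡-Reasoning

extend : ∀ {A : Set} → A → (Fin n → A) → ℕ → A
extend {zero}  a f _       = a
extend {suc n} a f zero    = f Fin.zero
extend {suc n} a f (suc k) = extend a (f ∘ Fin.suc) k

extend-toℕ : ∀ {A : Set} (a : A) (f : Fin n → A) v → extend a f (toℕ v) ≡ f v
extend-toℕ a f Fin.zero    = refl
extend-toℕ a f (Fin.suc v) = extend-toℕ a (f ∘ Fin.suc) v

-- One period: tours with an extra tour after every eighth

module _ (G : MetricGraph n) (φ : Fin n → ℚ) (φ-bounds : ∀ v → 0ℚ ≤ℚ φ v × φ v ≤ℚ 1ℚ)
         {B : ℚ} (0≤B : 0ℚ ≤ℚ B) (T : Tours G φ B) where
  open Tours T

  0≤pathLen : ∀ u l w → 0ℚ ≤ℚ pathLen G u l w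
  0≤pathLen u []      w = 0≤d G u w
  0≤pathLen u (x ∷ l) w = 0≤d G u x +≤ 0≤pathLen x l w

  elapsed-suc : ∀ b → elapsed b ≤ℚ elapsed (suc b)
  elapsed-suc b = linear (tour≤ b +≤ 0≤pathLen root (tour b) root)
    (solve 3 (λ e e′ p → e :+ (e′ :+ p) := e′ :+ (e :+ p :+ con 0ℚ)) refl (elapsed b) (elapsed (suc b)) _)

  -- Blocks are taken in pairs, each of length at least `B`; the additional `B` pays for an unpaired
  -- block.
  blocks≥ : ∀ a m → nat m *ℚ B ≤ℚ nat 2 *ℚ (elapsed (m + a) -ℚ elapsed a) +ℚ B
  blocks≥ a zero = linear 0≤B
    (solve 2 (λ e b → con 0ℚ :* b :+ b := con (nat 2) :* (e :- e) :+ b :+ con 0ℚ) refl (elapsed a) B)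
  blocks≥ a (suc zero) = linear (elapsed-suc a +≤ elapsed-suc a)
    (solve 3 (λ e e′ b → con 1ℚ :* b :+ (e′ :+ e′) := con (nat 2) :* (e′ :- e) :+ b :+ (e :+ e)) refl (elapsed a) (elapsed (suc a)) B)
  blocks≥ a (suc (suc m)) = linear (blocks≥ a m +≤ twoBlocks≥ (m + a) +≤ twoBlocks≥ (m + a))
    (solve 5 (λ k e f e′ b → (con 1ℚ :+ (con 1ℚ :+ k)) :* b :+ (con (nat 2) :* (f :- e) :+ b :+ e′ :+ e′)
                := con (nat 2) :* (e′ :- e) :+ b :+ (k :* b :+ (f :+ b) :+ (f :+ b))) refl
       (nat m) (elapsed a) (elapsed (m + a)) (elapsed (2 + m + a)) B)

  Missed : Fin n → ℕ → ℕ → Set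
  Missed v a b = ∀ k → a ≤ k → k < b → ¬ v ∈ root ∷ tour k

  φB≤B : ∀ v → φ v *ℚ B ≤ℚ B
  φB≤B v = subst₂ _≤ℚ_ (ℚ.*-comm B (φ v)) (ℚ.*-identityʳ B) (scale B 0≤B (proj₂ (φ-bounds v)))

  scaleφ : ∀ v {x y} → x ≤ℚ y → φ v *ℚ x ≤ℚ φ v *ℚ y
  scaleφ v = scale (φ v) (proj₁ (φ-bounds v))

  -- Scaling `blocks≥` by `φ v` gives 3 = 2 + 1: twice the bound `missed≤`, and `φ v ≤ 1` for the
  -- unpaired block.
  missed-count : ∀ v a m → Missed v a (m + a) → φ v *ℚ (nat m *ℚ B) ≤ℚ nat 3 *ℚ B
  missed-count v a m none =
    linear (scaleφ v (blocks≥ a m) +≤ missed≤ v a (m + a) (ℕ.m≤n+m a m) none +≤ missed≤ v a (m + a) (ℕ.m≤n+m a m) none +≤ φB≤B v)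
      (solve 5 (λ f k b e e′ → f :* (k :* b) :+ (f :* (con (nat 2) :* (e′ :- e) :+ b) :+ b :+ b :+ b)
                  := con (nat 3) :* b :+ (f :* (k :* b) :+ f :* (e′ :- e) :+ f :* (e′ :- e) :+ f :* b)) refl
        (φ v) (nat m) B (elapsed a) (elapsed (m + a)))

  private
    -- The index of a tour through a given vertex. The default 0 applies only from `n` on, which
    -- `b / 8` does not reach within a period.
    β : ℕ → ℕ
    β = extend 0 (λ v → proj₁ (visited v))

    -- Charges `B` for each extra tour inserted before unit `b`.
    detourLen : ℕ → ℚ
    detourLen b = nat (b / 8) *ℚ B

  ∈-detour : ∀ v → v ∈ root ∷ tour (β (toℕ v))
  ∈-detour v = subst (λ b → v ∈ root ∷ tour b) (sym (extend-toℕ 0 (λ v → proj₁ (visited v)) v)) (proj₂ (visited v))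

  unit : ℕ → List (Fin n)
  unit b with b % 8 ℕ.≟ 7
  ... | yes _ = tour b ++ root ∷ tour (β (b / 8))
  ... | no  _ = tour b

  -- Its differences bound the length of the word between the starts of two units.
  clock : ℕ → ℚ
  clock b = elapsed b +ℚ detourLen b

  unit-adjacent : ∀ b → Adjacent root (unit b) root
  unit-adjacent b with b % 8 ℕ.≟ 7
  ... | yes _ = Adjacent-++ (tour b) (adjacent b) (adjacent (β (b / 8)))
  ... | no  _ = adjacent b

  unit-short : ∀ b → length (root ∷ unit b) ≤ n + n
  unit-short b with b % 8 ℕ.≟ 7
  ... | yes _ = subst (_≤ n + n) (sym (length-++ (root ∷ tour b))) (ℕ.+-mono-≤ (short b) (short (β (b / 8))))
  ... | no  _ = ℕ.≤-trans (short b) (ℕ.m≤m+n n n)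

  tour⊆unit : ∀ {v} b → v ∈ root ∷ tour b → v ∈ root ∷ unit b
  tour⊆unit b v∈ with b % 8 ℕ.≟ 7
  ... | yes _ = ∈-++⁺ˡ v∈
  ... | no  _ = v∈

  -- The last of the eight units with quotient `toℕ v`; it carries the extra tour for `v`.
  slot : Fin n → ℕ
  slot v = 7 + toℕ v * 8

  ∈-slot : ∀ v → v ∈ root ∷ unit (slot v)
  ∈-slot v with slot v % 8 ℕ.≟ 7
  ... | yes _ = ∈-++⁺ʳ (root ∷ tour (slot v)) (subst (λ b → v ∈ root ∷ tour (β b)) (sym slot/8) (∈-detour v))
    where
    slot/8 : slot v / 8 ≡ toℕ v
    slot/8 = trans (+-distrib-/-∣ʳ 7 {toℕ v * 8} {8} (divides (toℕ v) refl)) (m*n/n≡m (toℕ v) 8)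
  ... | no ≢7 = contradiction ([m+kn]%n≡m%n 7 (toℕ v) 8) ≢7

  slot< : ∀ v → slot v < n * 8
  slot< v = ℕ.*-monoˡ-≤ 8 (Fin.toℕ<n v)

  tourLen≤B : ∀ b → pathLen G root (tour b) root ≤ℚ B
  tourLen≤B b = linear (tour≤ b +≤ block≤ b)
    (solve 4 (λ p e e′ b → p :+ (e′ :+ (e :+ b)) := b :+ (e :+ p :+ e′)) refl (pathLen G root (tour b) root) (elapsed b) (elapsed (suc b)) B)

  unit≤ : ∀ b → clock b +ℚ pathLen G root (unit b) root ≤ℚ clock (suc b)
  unit≤ b with b % 8 ℕ.≟ 7
  ... | yes ≡7 rewrite suc-/8-≡ b ≡7 | pathLen-++ G root (tour b) root (tour (β (b / 8))) root =
        linear (tour≤ b +≤ tourLen≤B (β (b / 8)))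
          (solve 6 (λ e e′ p q g b → e :+ g :* b :+ (p :+ q) :+ (e′ :+ b) := e′ :+ (con 1ℚ :+ g) :* b :+ (e :+ p :+ q)) refl
            (elapsed b) (elapsed (suc b)) (pathLen G root (tour b) root) (pathLen G root (tour (β (b / 8))) root) (nat (b / 8)) B)
  ... | no  ≢7 rewrite suc-/8-≢ b ≢7 = linear (tour≤ b)
          (solve 4 (λ e e′ p g → e :+ g :+ p :+ e′ := e′ :+ g :+ (e :+ p)) refl (elapsed b) (elapsed (suc b)) _ (nat (b / 8) *ℚ B))

  detour≤ : ∀ b → detourLen (suc b) ≤ℚ detourLen b +ℚ B
  detour≤ b with b % 8 ℕ.≟ 7
  ... | yes ≡7 rewrite suc-/8-≡ b ≡7 = ℚ.≤-reflexive
          (solve 2 (λ g b → (con 1ℚ :+ g) :* b := g :* b :+ b) refl (nat (b / 8)) B)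
  ... | no  ≢7 rewrite suc-/8-≢ b ≢7 = linear 0≤B
          (solve 2 (λ g b → g :+ b := g :+ b :+ con 0ℚ) refl (nat (b / 8) *ℚ B) B)

  clock-suc : ∀ b → clock b ≤ℚ clock (suc b)
  clock-suc b = linear (unit≤ b +≤ 0≤pathLen root (unit b) root)
    (solve 3 (λ e e′ p → e :+ (e′ :+ p) := e′ :+ (e :+ p :+ con 0ℚ)) refl (clock b) (clock (suc b)) _)

  clock-mono : ∀ {a b} → a ≤ b → clock a ≤ℚ clock b
  clock-mono {b = zero} z≤n = ℚ.≤-refl
  clock-mono {a} {suc b} a≤ with ℕ.m≤n⇒m<n∨m≡n a≤
  ... | inj₁ (s≤s a≤b) = ℚ.≤-trans (clock-mono a≤b) (clock-suc b)
  ... | inj₂ refl      = ℚ.≤-refl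

  private
    nat-scaled : ∀ {a b} → a ≤ b → nat a *ℚ B ≤ℚ nat b *ℚ B
    nat-scaled {a} {b} a≤b = subst₂ _≤ℚ_ (ℚ.*-comm B (nat a)) (ℚ.*-comm B (nat b)) (scale B 0≤B (nat-mono a≤b))

    detour≥ : ∀ b → nat b *ℚ B ≤ℚ nat 8 *ℚ detourLen b +ℚ nat 7 *ℚ B
    detour≥ b = subst (nat b *ℚ B ≤ℚ_) eq (nat-scaled {b} {7 + b / 8 * 8}
        (subst (_≤ 7 + b / 8 * 8) (sym (m≡m%n+[m/n]*n b 8)) (ℕ.+-monoˡ-≤ (b / 8 * 8) (ℕ.s≤s⁻¹ (m%n<n b 8)))))
      where
      eq : nat (7 + b / 8 * 8) *ℚ B ≡ nat 8 *ℚ detourLen b +ℚ nat 7 *ℚ B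
      eq rewrite nat-+ 7 (b / 8 * 8) | nat-* (b / 8) 8 =
        solve 2 (λ g b → (con (nat 7) :+ g :* con (nat 8)) :* b := con (nat 8) :* (g :* b) :+ con (nat 7) :* b) refl (nat (b / 8)) B

    detour≤count : ∀ b → nat 8 *ℚ detourLen b ≤ℚ nat b *ℚ B
    detour≤count b = subst (_≤ℚ nat b *ℚ B) eq (nat-scaled (m/n*n≤m b 8))
      where
      eq : nat (b / 8 * 8) *ℚ B ≡ nat 8 *ℚ detourLen b
      eq rewrite nat-* (b / 8) 8 =
        solve 2 (λ g b → (g :* con (nat 8)) :* b := con (nat 8) :* (g :* b)) refl (nat (b / 8)) B

  -- 27 = 8 + 8 + 3 + 8: the missed stretch, block `x`, and the extra tours. Eight times the number
  -- of the latter is at most `m + 8`, where `m` contributes 3 by `missed-count`.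
  missed-after : ∀ v x m → Missed v (suc x) (m + suc x) →
                 nat 8 *ℚ (φ v *ℚ (clock (m + suc x) -ℚ clock x)) ≤ℚ nat 27 *ℚ B
  missed-after v x m none =
    linear (scale (nat 8) (0≤nat 8) (missed≤ v (suc x) (m + suc x) (ℕ.m≤n+m (suc x) m) none +≤ scaleφ v (block≤ x) +≤ φB≤B v)
            +≤ scaleφ v (detour≥ x) +≤ scaleφ v (subst (λ c → nat 8 *ℚ detourLen (m + suc x) ≤ℚ c *ℚ B) (nat-+ m (suc x)) (detour≤count (m + suc x)))
            +≤ missed-count v (suc x) m none +≤ scale (nat 8) (0≤nat 8) (φB≤B v))
      (solve 9 (λ f b e₀ e₁ e₂ r₀ r₂ k x →
         con (nat 8) :* (f :* (e₂ :+ r₂ :- (e₀ :+ r₀)))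
           :+ (con (nat 8) :* (b :+ f :* (e₀ :+ b) :+ b) :+ f :* (con (nat 8) :* r₀ :+ con (nat 7) :* b) :+ f :* ((k :+ (con 1ℚ :+ x)) :* b)
               :+ con (nat 3) :* b :+ con (nat 8) :* b)
         := con (nat 27) :* b
           :+ (con (nat 8) :* (f :* (e₂ :- e₁) :+ f :* e₁ :+ f :* b) :+ f :* (x :* b) :+ f :* (con (nat 8) :* r₂)
               :+ f :* (k :* b) :+ con (nat 8) :* (f :* b))) refl
        (φ v) B (elapsed x) (elapsed (suc x)) (elapsed (m + suc x)) (detourLen x) (detourLen (m + suc x)) (nat m) (nat x))

  -- 20 = 8 + 8 + 3 + 1. As `missed-after`, except that counting from 0 bounds eight times the
  -- number of extra tours by `y + 1`.
  missed-before : ∀ v y → Missed v 0 y → nat 8 *ℚ (φ v *ℚ (clock (suc y) -ℚ clock 0)) ≤ℚ nat 20 *ℚ B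
  missed-before v y none =
    linear (scale (nat 8) (0≤nat 8) (missed≤ v 0 y z≤n none +≤ scaleφ v (block≤ y) +≤ φB≤B v)
            +≤ scaleφ v (detour≤count (suc y)) +≤ missed-count v 0 y (subst (Missed v 0) (sym (ℕ.+-identityʳ y)) none) +≤ φB≤B v)
      (solve 7 (λ f b e₀ e₁ e₂ r₂ y →
         con (nat 8) :* (f :* (e₂ :+ r₂ :- (e₀ :+ con 0ℚ :* b)))
           :+ (con (nat 8) :* (b :+ f :* (e₁ :+ b) :+ b) :+ f :* ((con 1ℚ :+ y) :* b) :+ con (nat 3) :* b :+ b)
         := con (nat 20) :* b
           :+ (con (nat 8) :* (f :* (e₁ :- e₀) :+ f :* e₂ :+ f :* b) :+ f :* (con (nat 8) :* r₂) :+ f :* (y :* b) :+ f :* b)) refl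
        (φ v) B (elapsed 0) (elapsed y) (elapsed (suc y)) (detourLen (suc y)) (nat y))

  -- 43 = 27 + 16: the unit that ends the stretch adds at most one block and one extra tour.
  missed-between : ∀ v x m → Missed v (suc x) (m + suc x) →
                   nat 8 *ℚ (φ v *ℚ (clock (suc (m + suc x)) -ℚ clock x)) ≤ℚ nat 43 *ℚ B
  missed-between v x m none =
    linear (missed-after v x m none +≤ scale (nat 8) (0≤nat 8) (scaleφ v (block≤ y +≤ detour≤ y) +≤ φB≤B v +≤ φB≤B v))
      (solve 7 (λ f b c₀ e₁ e₂ r₁ r₂ →
         con (nat 8) :* (f :* (e₂ :+ r₂ :- c₀)) :+ (con (nat 27) :* b :+ con (nat 8) :* (f :* (e₁ :+ b :+ (r₁ :+ b)) :+ b :+ b))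
         := con (nat 43) :* b :+ (con (nat 8) :* (f :* (e₁ :+ r₁ :- c₀)) :+ con (nat 8) :* (f :* (e₂ :+ r₂) :+ f :* b :+ f :* b))) refl
        (φ v) B (clock x) (elapsed y) (elapsed (suc y)) (detourLen y) (detourLen (suc y)))
    where y = m + suc x

  word : ℕ → List (Fin n)
  word zero    = []
  word (suc m) = word m ++ root ∷ unit m

  offset : ℕ → ℕ
  offset m = length (word m)

  offset-suc : ∀ m → offset (suc m) ≡ offset m + suc (length (unit m))
  offset-suc m = length-++ (word m)

  offset-mono : ∀ {a b} → a ≤ b → offset a ≤ offset b
  offset-mono {b = zero} z≤n = ℕ.≤-refl
  offset-mono {a} {suc b} a≤ with ℕ.m≤n⇒m<n∨m≡n a≤
  ... | inj₁ (s≤s a≤b) = ℕ.≤-trans (offset-mono a≤b) (subst (offset b ≤_) (sym (offset-suc b)) (ℕ.m≤m+n (offset b) _))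
  ... | inj₂ refl      = ℕ.≤-refl

  offset≤ : ∀ m → offset m ≤ m * (n + n)
  offset≤ zero    = z≤n
  offset≤ (suc m) = subst₂ _≤_ (sym (offset-suc m)) (ℕ.+-comm (m * (n + n)) (n + n)) (ℕ.+-mono-≤ (offset≤ m) (unit-short m))

  Follows-word : ∀ (U : ℕ → Fin n) i m → Follows U i (word m) → ∀ x → x < m → Follows U (i + offset x) (root ∷ unit x)
  Follows-word U i (suc m) f x (s≤s x≤m) with Follows-++⁻ U i (word m) f | ℕ.m≤n⇒m<n∨m≡n x≤m
  ... | f₁ , _  | inj₁ x<m  = Follows-word U i m f₁ x x<m
  ... | _  , f₂ | inj₂ refl = f₂

  private
    N : ℕ
    N = n * 8

    ℓ : ℕ
    ℓ = offset N

    0<N : 0 < N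
    0<N = ℕ.≤-<-trans z≤n (slot< root)

    0<ℓ : 0 < ℓ
    0<ℓ = ℕ.<-≤-trans (subst (0 <_) (sym (offset-suc 0)) (s≤s z≤n)) (offset-mono {1} 0<N)

  -- There are `8n` units, each made of at most two tours of at most `n` vertices.
  word-short : ℓ ≤ 16 * (n * n)
  word-short = subst (ℓ ≤_) (rearrange n) (offset≤ N)
    where
    rearrange : ∀ n → n * 8 * (n + n) ≡ 16 * (n * n)
    rearrange = ℕ-Solver.solve-∀

  -- The cost of the periodic walk

  module _ (U : ℕ → Fin n) (periodic : ∀ q → Follows U (q * ℓ) (word N)) where
    private
      pos : ℕ → ℕ → ℕ
      pos q x = q * ℓ + offset x

      Dᵁ : ℕ → ℚ
      Dᵁ = odometer G U

      pos-wrap : ∀ q → pos q N ≡ pos (suc q) 0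
      pos-wrap q = trans (ℕ.+-comm (q * ℓ) ℓ) (sym (ℕ.+-identityʳ (ℓ + q * ℓ)))

      pos-suc : ∀ q x → pos q (suc x) ≡ pos q x + suc (length (unit x))
      pos-suc q x = trans (cong (q * ℓ +_) (offset-suc x)) (sym (ℕ.+-assoc (q * ℓ) (offset x) _))

      follows-unit : ∀ q x → x < N → Follows U (pos q x) (root ∷ unit x)
      follows-unit q x = Follows-word U (q * ℓ) N (periodic q) x

      at-root : ∀ q x → x ≤ N → U (pos q x) ≡ root
      at-root q x x≤N with ℕ.m≤n⇒m<n∨m≡n x≤N
      ... | inj₁ x<N  = proj₁ (follows-unit q x x<N)
      ... | inj₂ refl = trans (cong U (pos-wrap q)) (proj₁ (follows-unit (suc q) 0 0<N))

      closes : ∀ q x → x < N → U (pos q x + suc (length (unit x))) ≡ root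
      closes q x x<N = trans (cong U (sym (pos-suc q x))) (at-root q (suc x) x<N)

      unit-odometer : ∀ q x → x < N → Dᵁ (pos q (suc x)) +ℚ clock x ≤ℚ Dᵁ (pos q x) +ℚ clock (suc x)
      unit-odometer q x x<N = subst (λ p → p +ℚ clock x ≤ℚ Dᵁ (pos q x) +ℚ clock (suc x))
        (sym (trans (cong Dᵁ (pos-suc q x)) (odometer-Follows G U (pos q x) (follows-unit q x x<N) (closes q x x<N))))
        (linear (unit≤ x) (solve 4 (λ o p c c′ → o :+ p :+ c :+ c′ := o :+ c′ :+ (c :+ p)) refl
          (Dᵁ (pos q x)) (pathLen G root (unit x) root) (clock x) (clock (suc x))))

      odometer≤clock : ∀ q x y → x ≤ y → y ≤ N → Dᵁ (pos q y) +ℚ clock x ≤ℚ Dᵁ (pos q x) +ℚ clock y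
      odometer≤clock q x zero z≤n y≤N = ℚ.≤-refl
      odometer≤clock q x (suc y) x≤ y<N with ℕ.m≤n⇒m<n∨m≡n x≤
      ... | inj₂ refl      = ℚ.≤-refl
      ... | inj₁ (s≤s x≤y) = linear (odometer≤clock q x y x≤y (ℕ.<⇒≤ y<N) +≤ unit-odometer q y y<N)
            (solve 6 (λ ox oy os cx cy cs → os :+ cx :+ (ox :+ cy :+ (oy :+ cs)) := ox :+ cs :+ (oy :+ cx :+ (os :+ cy))) refl
              (Dᵁ (pos q x)) (Dᵁ (pos q y)) (Dᵁ (pos q (suc y))) (clock x) (clock y) (clock (suc y)))

      pos-mono : ∀ q {a b} → a ≤ b → pos q a ≤ pos q b
      pos-mono q a≤b = ℕ.+-monoʳ-≤ (q * ℓ) (offset-mono a≤b)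

      locate : ∀ i → ∃ λ q → ∃ λ x → x < N × pos q x ≤ i × i < pos q (suc x)
      locate i with bracket (_* ℓ) (suc i) {i} z≤n (ℕ.m≤m*n (suc i) ℓ {{ℕ.>-nonZero 0<ℓ}})
      ... | q , _ , q≤ , <q with bracket (pos q) N {i} (subst (_≤ i) (sym (ℕ.+-identityʳ (q * ℓ))) q≤)
                                   (subst (i <_) (ℕ.+-comm ℓ (q * ℓ)) <q)
      ...   | x , x<N , x≤ , <x = q , x , x<N , x≤ , <x

      -- 47 is below 48, which is 8 times 6.
      eighth : ∀ {x} → nat 8 *ℚ x ≤ℚ nat 47 *ℚ B → x ≤ℚ six *ℚ B
      eighth {x} 8x≤ = ℚ.*-cancelˡ-≤-pos (nat 8) (linear (8x≤ +≤ 0≤B)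
        (solve 2 (λ x b → con (nat 8) :* x :+ (con (nat 47) :* b :+ b) := con (nat 8) :* (con six :* b) :+ (con (nat 8) :* x :+ con 0ℚ)) refl x B))

      -- Measured from the start of unit `x` to a visit at or after its end, so that it bounds the
      -- gap following any occurrence of `v` inside the unit.
      Next : ℕ → ℕ → Fin n → Set
      Next q x v = ∃ λ j → pos q (suc x) ≤ j × U j ≡ v × φ v *ℚ (Dᵁ j -ℚ Dᵁ (pos q x)) ≤ℚ six *ℚ B

      in-unit : ∀ q y → y < N → ∀ {v} → v ∈ root ∷ unit y →
                ∃ λ j → pos q y ≤ j × U j ≡ v × Dᵁ j ≤ℚ Dᵁ (pos q (suc y))
      in-unit q y y<N v∈ with Follows-∈ U (pos q y) (follows-unit q y y<N) v∈
      ... | j , y≤j , j< , Uj = j , y≤j , Uj , odometer-mono G U (ℕ.<⇒≤ (subst (j <_) (sym (pos-suc q y)) j<))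

      next-same : ∀ q x y v → x < y → y < N → v ∈ root ∷ unit y →
                  nat 8 *ℚ (φ v *ℚ (clock (suc y) -ℚ clock x)) ≤ℚ nat 43 *ℚ B → Next q x v
      next-same q x y v x<y y<N v∈ bound with in-unit q y y<N v∈
      ... | j , y≤j , Uj , Dj≤ = j , ℕ.≤-trans (pos-mono q x<y) y≤j , Uj ,
        -- The non-negative `4B` lifts 43 to the 47 that `eighth` expects.
        eighth (linear (bound +≤ 0≤nat-B 4 +≤ scale (nat 8) (0≤nat 8) (scaleφ v (Dj≤ +≤ odometer≤clock q x (suc y) (ℕ.m≤n⇒m≤1+n (ℕ.<⇒≤ x<y)) y<N)))
          (solve 7 (λ f b cx cy o oj oy →
             con (nat 8) :* (f :* (oj :- o)) :+ (con (nat 43) :* b :+ con (nat 4) :* b :+ con (nat 8) :* (f :* (oy :+ (o :+ cy))))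
             := con (nat 47) :* b :+ (con (nat 8) :* (f :* (cy :- cx)) :+ con 0ℚ :+ con (nat 8) :* (f :* (oj :+ (oy :+ cx))))) refl
            (φ v) B (clock x) (clock (suc y)) (Dᵁ (pos q x)) (Dᵁ j) (Dᵁ (pos q (suc y)))))
        where
        0≤nat-B : ∀ k → 0ℚ ≤ℚ nat k *ℚ B
        0≤nat-B k = subst (_≤ℚ nat k *ℚ B) (ℚ.*-zeroʳ (nat k)) (scale (nat k) (0≤nat k) 0≤B)

      -- 47 = 27 + 20: the rest of this period from unit `x`, then the next period up to the end of
      -- unit `y`.
      next-wrap : ∀ q x y v → x < N → y < N → v ∈ root ∷ unit y →
                  nat 8 *ℚ (φ v *ℚ (clock N -ℚ clock x)) ≤ℚ nat 27 *ℚ B →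
                  nat 8 *ℚ (φ v *ℚ (clock (suc y) -ℚ clock 0)) ≤ℚ nat 20 *ℚ B → Next q x v
      next-wrap q x y v x<N y<N v∈ after before with in-unit (suc q) y y<N v∈
      ... | j , y≤j , Uj , Dj≤ = j , ℕ.≤-trans (pos-mono q x<N) (ℕ.≤-trans (ℕ.≤-reflexive (pos-wrap q)) (ℕ.≤-trans (pos-mono (suc q) {0} {y} z≤n) y≤j)) , Uj ,
        eighth (linear (after +≤ before +≤ scale (nat 8) (0≤nat 8) (scaleφ v (Dj≤ +≤ odometer≤clock (suc q) 0 (suc y) z≤n y<N
                  +≤ subst (λ p → Dᵁ p +ℚ clock x ≤ℚ Dᵁ (pos q x) +ℚ clock N) (pos-wrap q) (odometer≤clock q x N (ℕ.<⇒≤ x<N) ℕ.≤-refl))))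
          (solve 10 (λ f b cx cN c0 cy o o0 oj oy →
             con (nat 8) :* (f :* (oj :- o)) :+ (con (nat 27) :* b :+ con (nat 20) :* b :+ con (nat 8) :* (f :* (oy :+ (o0 :+ cy) :+ (o :+ cN))))
             := con (nat 47) :* b :+ (con (nat 8) :* (f :* (cN :- cx)) :+ con (nat 8) :* (f :* (cy :- c0)) :+ con (nat 8) :* (f :* (oj :+ (oy :+ c0) :+ (o0 :+ cx))))) refl
            (φ v) B (clock x) (clock N) (clock 0) (clock (suc y)) (Dᵁ (pos q x)) (Dᵁ (pos (suc q) 0)) (Dᵁ j) (Dᵁ (pos (suc q) (suc y)))))

      -- The search goes through the later tours of this period, then the tours of the next period;
      -- if both fail, the extra tour for `v` is taken.
      next : ∀ q x v → x < N → Next q x v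
      next q x v x<N with ℕ.m∸n+n≡m x<N | least (λ k → _∈?_ Fin._≟_ v (root ∷ tour k)) (suc x) (N ∸ suc x)
      ... | N≡ | inj₁ (y , x<y , y< , v∈ , none) =
            next-same q x y v x<y (subst (y <_) (trans (ℕ.+-comm (suc x) _) N≡) y<) (tour⊆unit y v∈)
              (subst (λ k → nat 8 *ℚ (φ v *ℚ (clock (suc k) -ℚ clock x)) ≤ℚ nat 43 *ℚ B) (ℕ.m∸n+n≡m x<y)
                (missed-between v x (y ∸ suc x) (subst (Missed v (suc x)) (sym (ℕ.m∸n+n≡m x<y)) none)))
      ... | N≡ | inj₂ none with least (λ k → _∈?_ Fin._≟_ v (root ∷ tour k)) 0 N
      ...   | inj₁ (y , _ , y<N , v∈ , none′) = next-wrap q x y v x<N y<N (tour⊆unit y v∈) after (missed-before v y none′)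
        where
        after = subst (λ k → nat 8 *ℚ (φ v *ℚ (clock k -ℚ clock x)) ≤ℚ nat 27 *ℚ B) N≡
          (missed-after v x (N ∸ suc x) (subst (Missed v (suc x)) (ℕ.+-comm (suc x) _) none))
      -- All `N` tours miss `v`, so `missed-before` applies to the whole period, and unit `slot v`
      -- ends within it.
      ...   | inj₂ none′ = next-wrap q x (slot v) v x<N (slot< v) (∈-slot v) after
                (ℚ.≤-trans (scale (nat 8) (0≤nat 8) (scaleφ v (ℚ.+-monoˡ-≤ (ℚ.- clock 0) (clock-mono (ℕ.m≤n⇒m≤1+n (slot< v))))))
                  (missed-before v N none′))
        where
        after = subst (λ k → nat 8 *ℚ (φ v *ℚ (clock k -ℚ clock x)) ≤ℚ nat 27 *ℚ B) N≡
          (missed-after v x (N ∸ suc x) (subst (Missed v (suc x)) (ℕ.+-comm (suc x) _) none))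

    word-walk : IsInfWalk U
    word-walk i with locate i
    ... | q , x , x<N , x≤i , i<x = subst (λ j → U j ≢ U (suc j)) (ℕ.m+[n∸m]≡n x≤i)
      (Follows-adjacent U (pos q x) (follows-unit q x x<N) (unit-adjacent x) (closes q x x<N) (i ∸ pos q x)
        (ℕ.s≤s⁻¹ (ℕ.+-cancelˡ-< (pos q x) _ _ (subst₂ _<_ (sym (ℕ.m+[n∸m]≡n x≤i)) (pos-suc q x) i<x))))

    word-cost : CostLE G φ U (six *ℚ B)
    word-cost v = recurs , latency≤
      where
      recurs : ∀ i → ∃ λ j → i ≤ j × U j ≡ v
      recurs i with locate i
      ... | q , x , x<N , _ , i<x with next q x v x<N
      ...   | j , x≤j , Uj , _ = j , ℕ.<⇒≤ (ℕ.<-≤-trans i<x x≤j) , Uj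
      latency≤ : ∀ i m → 1 ≤ m → U i ≡ v → U (i + m) ≡ v → (∀ k → 1 ≤ k → k < m → U (i + k) ≢ v) →
                 φ v *ℚ segLen G U i m ≤ℚ six *ℚ B
      latency≤ i m 1≤m Ui Um none with locate i
      ... | q , x , x<N , x≤i , i<x with next q x v x<N
      ...   | j , x≤j , Uj , bound = ℚ.≤-trans (scaleφ v
                (linear (odometer-mono G U i+m≤j +≤ odometer-mono G U x≤i +≤ ℚ.≤-reflexive (segLen-odometer G U i m))
                  (solve 5 (λ s oi om oj ox → s :+ (oj :+ oi :+ om) := oj :- ox :+ (om :+ ox :+ (s :+ oi))) refl
                    (segLen G U i m) (Dᵁ i) (Dᵁ (i + m)) (Dᵁ j) (Dᵁ (pos q x))))) bound
        where
        i<j : i < j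
        i<j = ℕ.<-≤-trans i<x x≤j
        -- Otherwise `j` would be an occurrence of `v` strictly between two consecutive ones.
        i+m≤j : i + m ≤ j
        i+m≤j = ℕ.≮⇒≥ λ j<i+m → none (j ∸ i) (ℕ.m<n⇒0<n∸m i<j)
          (ℕ.+-cancelˡ-< i _ _ (subst (_< i + m) (sym (ℕ.m+[n∸m]≡n (ℕ.<⇒≤ i<j))) j<i+m))
          (trans (cong U (ℕ.m+[n∸m]≡n (ℕ.<⇒≤ i<j))) Uj)

  cheapWord : Σ ℕ λ k → Σ (Vec (Fin n) (suc k)) λ W →
              suc k ≤ 16 * (n * n) × IsInfWalk (Δ W) × CostLE G φ (Δ W) (six *ℚ B)
  cheapWord with Δ-of (word N) 0<ℓ
  ... | k , W , k≡ , periodic = k , W , subst (_≤ 16 * (n * n)) (sym k≡) word-short ,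
        word-walk (Δ W) periodic , word-cost (Δ W) periodic

-- A cheapest word

toℕ-mod : ∀ i k → toℕ (i mod suc k) ≡ i % suc k
toℕ-mod i k = Fin.toℕ-fromℕ< (m%n<n i (suc k))

Δ-periodic : ∀ (W : Vec (Fin n) (suc k)) i q → Δ W (i + q * suc k) ≡ Δ W i
Δ-periodic {k = k} W i q = cong (Vec.lookup W) (Fin.toℕ-injective
  (trans (toℕ-mod (i + q * suc k) k) (trans ([m+kn]%n≡m%n i q (suc k)) (sym (toℕ-mod i k)))))

Δ-% : ∀ (W : Vec (Fin n) (suc k)) i m → Δ W (i + m) ≡ Δ W (i % suc k + m)
Δ-% {k = k} W i m = begin
  Δ W (i + m)                                    ≡⟨ cong (λ j → Δ W (j + m)) (m≡m%n+[m/n]*n i (suc k)) ⟩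
  Δ W (i % suc k + i / suc k * suc k + m)        ≡⟨ cong (Δ W) (ℕ.+-assoc (i % suc k) _ m) ⟩
  Δ W (i % suc k + (i / suc k * suc k + m))      ≡⟨ cong (λ j → Δ W (i % suc k + j)) (ℕ.+-comm _ m) ⟩
  Δ W (i % suc k + (m + i / suc k * suc k))      ≡⟨ cong (Δ W) (ℕ.+-assoc (i % suc k) m _) ⟨
  Δ W (i % suc k + m + i / suc k * suc k)        ≡⟨ Δ-periodic W (i % suc k + m) (i / suc k) ⟩
  Δ W (i % suc k + m)                            ∎
  where open ≡-Reasoning

Δ-%′ : ∀ (W : Vec (Fin n) (suc k)) i → Δ W i ≡ Δ W (i % suc k)
Δ-%′ {k = k} W i = trans (cong (Δ W) (sym (ℕ.+-identityʳ i))) (trans (Δ-% W i 0) (cong (Δ W) (ℕ.+-identityʳ (i % suc k))))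

segLen-cong : ∀ (G : MetricGraph n) {U V : ℕ → Fin n} i j m → (∀ k → U (i + k) ≡ V (j + k)) → segLen G U i m ≡ segLen G V j m
segLen-cong G i j zero    eq = refl
segLen-cong G {U} {V} i j (suc m) eq = cong₂ _+ℚ_
  (cong₂ (d G) (shift 0 (ℕ.+-identityʳ i) (ℕ.+-identityʳ j)) (shift 1 (ℕ.+-comm i 1) (ℕ.+-comm j 1)))
  (segLen-cong G (suc i) (suc j) m λ k → shift (suc k) (ℕ.+-suc i k) (ℕ.+-suc j k))
  where
  shift : ∀ k {a b} → i + k ≡ a → j + k ≡ b → U a ≡ V b
  shift k refl refl = eq k

-- The premise `k < m` comes first to fit the bounded decision procedure `ℕ.allUpTo?`.
FirstReturn : (ℕ → Fin n) → ℕ × ℕ → Set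
FirstReturn U (i , m) = 1 ≤ m × U (i + m) ≡ U i × (∀ {k} → k < m → 1 ≤ k → U (i + k) ≢ U i)

firstReturn? : ∀ (U : ℕ → Fin n) → Decidable (FirstReturn U)
firstReturn? U (i , m) = (1 ℕ.≤? m) ×-dec (U (i + m) Fin.≟ U i) ×-dec
  ℕ.allUpTo? (λ k → (1 ℕ.≤? k) →-dec ¬? (U (i + k) Fin.≟ U i)) m

Word : ℕ → Set
Word n = Σ ℕ λ k → Vec (Fin n) (suc k)

-- Only one period is inspected, which makes the conditions decidable; periodicity carries them to
-- the infinite walk.
Admissible : ℕ → Word n → Set
Admissible s (k , W) = suc k ≤ s × (∀ (i : Fin (suc k)) → Δ W (toℕ i) ≢ Δ W (suc (toℕ i))) ×
                       (∀ v → ∃ λ (i : Fin (suc k)) → Δ W (toℕ i) ≡ v)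

admissible? : ∀ s → Decidable (Admissible {n} s)
admissible? s (k , W) = (suc k ℕ.≤? s) ×-dec
  Fin.all? (λ i → ¬? (Δ W (toℕ i) Fin.≟ Δ W (suc (toℕ i)))) ×-dec
  Fin.all? (λ v → Fin.any? λ i → Δ W (toℕ i) Fin.≟ v)

admissible⇒walk : ∀ {s k} {W : Vec (Fin n) (suc k)} → Admissible s (k , W) → IsInfWalk (Δ W)
admissible⇒walk {k = k} {W} (_ , walk , _) i eq = walk (i mod suc k) (begin
  Δ W (toℕ (i mod suc k))       ≡⟨ cong (Δ W) (toℕ-mod i k) ⟩
  Δ W (i % suc k)               ≡⟨ Δ-%′ W i ⟨
  Δ W i                         ≡⟨ eq ⟩
  Δ W (suc i)                   ≡⟨ cong (Δ W) (ℕ.+-comm 1 i) ⟩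
  Δ W (i + 1)                   ≡⟨ Δ-% W i 1 ⟩
  Δ W (i % suc k + 1)           ≡⟨ cong (Δ W) (ℕ.+-comm _ 1) ⟩
  Δ W (suc (i % suc k))         ≡⟨ cong (Δ W ∘ suc) (toℕ-mod i k) ⟨
  Δ W (suc (toℕ (i mod suc k))) ∎)
  where open ≡-Reasoning

vectors : ∀ m → List (Vec (Fin n) m)
vectors zero    = [] ∷ []
vectors (suc m) = cartesianProductWith _∷_ (allFin _) (vectors m)

∈-vectors : ∀ {m} (W : Vec (Fin n) m) → W ∈ vectors m
∈-vectors []      = here refl
∈-vectors (x ∷ W) = ∈-cartesianProductWith⁺ _∷_ (∈-allFin x) (∈-vectors W)

wordsUpTo : ℕ → List (Word n)
wordsUpTo s = concatMap (λ k → map (k ,_) (vectors (suc k))) (upTo s)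

∈-wordsUpTo : ∀ {s k} → suc k ≤ s → (W : Vec (Fin n) (suc k)) → (k , W) ∈ wordsUpTo s
∈-wordsUpTo {k = k} k<s W = ∈-concat⁺′ (∈-map⁺ (k ,_) (∈-vectors W)) (∈-map⁺ _ (∈-upTo⁺ k<s))

-- Listing all vertices cyclically provides the fallback value that `argmin` takes.
roundTrip : ∀ n → 2 ≤ n → ∃ λ (W : Word n) → Admissible n W
roundTrip (suc zero) (s≤s ())
roundTrip (suc (suc k)) _ = (suc k , Vec.allFin _) , ℕ.≤-refl , walk , λ v → v , visit v
  where
  s = suc (suc k)
  label : ∀ i → toℕ (Δ (Vec.allFin s) i) ≡ i % s
  label i = trans (cong toℕ (Vec.lookup-allFin (i mod s))) (toℕ-mod i (suc k))
  visit : ∀ v → Δ (Vec.allFin s) (toℕ v) ≡ v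
  visit v = Fin.toℕ-injective (trans (label (toℕ v)) (m<n⇒m%n≡m (Fin.toℕ<n v)))
  walk : ∀ i → Δ (Vec.allFin s) (toℕ i) ≢ Δ (Vec.allFin s) (suc (toℕ i))
  walk i eq with ℕ.m≤n⇒m<n∨m≡n (Fin.toℕ<n i) | trans (sym (cong toℕ (visit i))) (trans (cong toℕ eq) (label (suc (toℕ i))))
  ... | inj₁ si<s | i≡ = ℕ.1+n≢n (sym (trans i≡ (m<n⇒m%n≡m si<s)))
  -- At the wrap, equality would make the last index 0, whereas it is `suc k`.
  ... | inj₂ si≡s | i≡ = ℕ.0≢1+n (trans (sym (trans i≡ (trans (cong (_% s) si≡s) (n%n≡0 s)))) (ℕ.suc-injective si≡s))

module _ (G : MetricGraph n) (φ : Fin n → ℚ) where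

  returnCost : (ℕ → Fin n) → ℕ × ℕ → ℚ
  returnCost U (i , m) = φ (U i) *ℚ segLen G U i m

  -- Gaps up to and including the period `suc k` are listed, since a vertex may occur only once per
  -- period.
  returns : Word n → List (ℕ × ℕ)
  returns (k , W) = filter (firstReturn? (Δ W)) (cartesianProduct (upTo (suc k)) (upTo (suc (suc k))))

  wordCost : Word n → ℚ
  wordCost (k , W) = max 0ℚ (map (returnCost (Δ W)) (returns (k , W)))

  -- Periodicity moves the start of a return into the first period, and no first return exceeds a
  -- period because the vertex recurs one period later.
  wordCost-sound : ∀ {s} (W : Word n) → Admissible s W → CostLE G φ (Δ (proj₂ W)) (wordCost W)
  wordCost-sound (k , W) (_ , _ , covers) v = recurs , latency≤
    where
    U = Δ W
    recurs : ∀ i → ∃ λ j → i ≤ j × U j ≡ v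
    recurs i with covers v
    ... | j , Uj = toℕ j + i * suc k , ℕ.≤-trans (ℕ.m≤m*n i (suc k)) (ℕ.m≤n+m _ (toℕ j)) , trans (Δ-periodic W (toℕ j) i) Uj
    latency≤ : ∀ i m → 1 ≤ m → U i ≡ v → U (i + m) ≡ v → (∀ k → 1 ≤ k → k < m → U (i + k) ≢ v) →
               φ v *ℚ segLen G U i m ≤ℚ wordCost (k , W)
    latency≤ i m 1≤m Ui Um none =
      subst (_≤ℚ wordCost (k , W)) (cong₂ _*ℚ_ (cong φ Ui₀) (sym (segLen-cong G i i₀ m (Δ-% W i))))
        (All.lookup (xs≤max 0ℚ (map (returnCost U) (returns (k , W))))
          (∈-map⁺ (returnCost U) (∈-filter⁺ (firstReturn? U) (∈-cartesianProduct⁺ (∈-upTo⁺ (m%n<n i (suc k))) (∈-upTo⁺ (s≤s m≤s))) first)))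
      where
      i₀ = i % suc k
      Ui₀ : U i₀ ≡ v
      Ui₀ = trans (sym (Δ-%′ W i)) Ui
      m≤s : m ≤ suc k
      m≤s = ℕ.≮⇒≥ λ s<m → none (suc k) (s≤s z≤n) s<m
        (trans (cong (λ j → U (i + j)) (sym (ℕ.+-identityʳ (suc k)))) (trans (Δ-periodic W i 1) Ui))
      first : FirstReturn U (i₀ , m)
      first = 1≤m , trans (sym (Δ-% W i m)) (trans Um (sym Ui₀)) ,
        λ {j} j<m 1≤j eq → none j 1≤j j<m (trans (Δ-% W i j) (trans eq Ui₀))

  wordCost-least : ∀ (W : Word n) {C} → 0ℚ ≤ℚ C → CostLE G φ (Δ (proj₂ W)) C → wordCost W ≤ℚ C
  wordCost-least (k , W) {C} 0≤C cost = max≤v⁺ 0≤C (All.map⁺ (All.tabulate bound))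
    where
    bound : ∀ {p} → p ∈ returns (k , W) → returnCost (Δ W) p ≤ℚ C
    bound {i , m} p∈ with proj₂ (∈-filter⁻ (firstReturn? (Δ W)) {xs = cartesianProduct (upTo (suc k)) (upTo (suc (suc k)))} p∈)
    ... | 1≤m , back , none = proj₂ (cost (Δ W i)) i m 1≤m refl back λ j 1≤j j<m → none j<m 1≤j

CostLE-weaken : ∀ (G : MetricGraph n) φ (U : ℕ → Fin n) {B C} → B ≤ℚ C → CostLE G φ U B → CostLE G φ U C
CostLE-weaken G φ U B≤C cost v = proj₁ (cost v) , λ i m 1≤m Ui Um none → ℚ.≤-trans (proj₂ (cost v) i m 1≤m Ui Um none) B≤C

covering⇒admissible : ∀ {C} (G : MetricGraph n) φ {s} (W : Word n) → proj₁ W < s → IsInfWalk (Δ (proj₂ W)) →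
           CostLE G φ (Δ (proj₂ W)) C → Admissible s W
covering⇒admissible G φ (k , W) short W-walk W-cost = short , (λ i → W-walk (toℕ i)) , λ v → visit v (proj₁ (W-cost v) 0)
  where
  visit : ∀ v → (∃ λ j → 0 ≤ j × Δ W j ≡ v) → ∃ λ (i : Fin (suc k)) → Δ W (toℕ i) ≡ v
  visit v (j , _ , Wj) = j mod suc k , trans (cong (Δ W) (toℕ-mod j k)) (trans (sym (Δ-%′ W j)) Wj)

module _ (G : MetricGraph n) (φ : Fin n → ℚ) (s : ℕ) (default : ∃ (Admissible {n} s)) where

  candidates : List (Word n)
  candidates = filter (admissible? s) (wordsUpTo s)

  best : Word n
  best = argmin (wordCost G φ) (proj₁ default) candidates

  best-admissible : Admissible s best
  best-admissible = argmin-all (wordCost G φ) (proj₂ default) (All.all-filter (admissible? s) (wordsUpTo s))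

  best-cost : ∀ {C} → 0ℚ ≤ℚ C → (W : Word n) → Admissible s W → CostLE G φ (Δ (proj₂ W)) C →
              CostLE G φ (Δ (proj₂ best)) C
  best-cost 0≤C W W-admissible W-cost = CostLE-weaken G φ (Δ (proj₂ best))
    (ℚ.≤-trans (All.lookup (f[argmin]≤f[xs] {f = wordCost G φ} (proj₁ default) candidates)
        (∈-filter⁺ (admissible? s) (∈-wordsUpTo (proj₁ W-admissible) (proj₂ W)) W-admissible))
      (wordCost-least G φ W 0≤C W-cost))
    (wordCost-sound G φ best best-admissible)

abstract
  defaultWord : 2 ≤ n → ∃ (Admissible {n} (16 * (n * n)))
  defaultWord {n} 2≤n with roundTrip n 2≤n
  ... | W , short , rest = W , ℕ.≤-trans short
    (ℕ.≤-trans (ℕ.m≤m*n n n {{ℕ.>-nonZero (ℕ.<-trans (s≤s z≤n) 2≤n)}}) (ℕ.m≤n*m (n * n) 16)) , rest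

theorem4p6 : ∃ λ (c : ℕ) →
    ∀ (n : ℕ) → 2 ≤ n → (G : MetricGraph n) (φ : Fin n → ℚ) →
    (∀ v → 0ℚ <ℚ φ v × φ v ≤ℚ 1ℚ) → (∃ λ v → φ v ≡ 1ℚ) →
    ∃ λ (k : ℕ) → Σ (Vec (Fin n) (suc k)) λ W →
    suc k ≤ c * (n * n) ×
    IsInfWalk (Δ W) ×
    (∀ (M : ℕ → Fin n) → IsInfWalk M → ∀ (B : ℚ) →
    CostLE G φ M B → CostLE G φ (Δ W) (six *ℚ B))
theorem4p6 = 16 , λ n 2≤n G φ φ-bounds (r , φr≡1) →
  let s       = 16 * (n * n)
      default = defaultWord 2≤n
      W*      = best G φ s default
      W*-ok   = best-admissible G φ s default
      0≤φ     = λ v → ℚ.<⇒≤ (proj₁ (φ-bounds v))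
  in proj₁ W* , proj₂ W* , proj₁ W*-ok , admissible⇒walk {W = proj₂ W*} W*-ok , λ M walk B cost →
  let 0≤B = 0≤bound G φ 0≤φ walk cost r
      -- This `W` depends on `M` and `B`, whereas `W*` was fixed before them; being a cheapest
      -- admissible word, `W*` inherits the bound on the cost of `W`.
      k , W , short , W-walk , W-cost =
        cheapWord G φ (λ v → 0≤φ v , proj₂ (φ-bounds v)) 0≤B (tours G φ 0≤φ walk cost r φr≡1)
  in best-cost G φ s default (subst (_≤ℚ six *ℚ B) (ℚ.*-zeroʳ six) (scale six (ℚ.nonNegative⁻¹ six) 0≤B))
       (k , W) (covering⇒admissible G φ (k , W) short W-walk W-cost) W-cost
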